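{- Let $n\ge 7$ be an integer and let $k=\left\lfloor \frac{n+1}{4}\right\rfloor$. Then \[ R(H_{5,2n}) = C(H_{5,2n}) - 2 + (k+2)2^{ -k}. \]
   Context: For a finite simple undirected graph $G$, the closeness is $C(G)=\sum_{i}\sum_{j\ne i}2^{ -d(i,j)}$, where the sum is over all ordered pairs of distinct vertices, $d(i,j)$ is the graph distance, and $2^{ -d(i,j)}=0$ if $i$ and $j$ lie in different components. The link residual closeness is $R(G)=\min_{(r,s)} C(G_{r,s})$, where the minimum is over all edges (links) $(r,s)$ of $G$ and $G_{r,s}$ is the graph obtained from $G$ by deleting the edge $(r,s)$ (keeping all vertices). For an integer $n\ge 3$, the Harary graph $H_{5,2n}$ has vertices $1,2,\dots,2n$ placed in a circle in this order, each vertex being joined to the nearest $2$ vertices in each direction along the circle and to the diametrically opposite vertex (so $i\ne j$ are adjacent iff $i-j$ is congruent to $\pm1$, $\pm2$ or $n$ modulo $2n$). -}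

module Defs where

open import Algebra.Definitions.RawMonoid using (sum)
open import Algebra.Definitions.RawSemiring using (_^_)
open import Data.Bool.Base using (if_then_else_)
open import Data.Fin.Base using (Fin; zero; suc; toℕ)
open import Data.Fin.Properties using (_≟_; any?; pigeonhole; toℕ≤pred[n])
open import Data.Integer.Base as ℤ using (ℤ; +_; -[1+_])
import Data.Integer.Properties as ℤ
open import Data.Integer.Divisibility.Signed using (_∣_; _∣?_; divides)
open import Data.Integer.Tactic.RingSolver using (solve-∀)
open import Data.List.Base using (List; []; _∷_; map; filter; find; upTo; applyUpTo; allFin; cartesianProduct)
import Data.List.Extrema
open import Data.List.Relation.Unary.Any as Any using (Any; here; there)
open import Data.Maybe.Base using (Maybe; just; nothing)
open import Data.Nat.Base as ℕ using (ℕ; zero; suc; _∸_; _≤_; _<_; z≤n; s≤s)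
open import Data.Nat.Induction using (<-rec)
import Data.Nat.Properties as ℕ
open import Data.Product.Base using (_×_; _,_; ∃-syntax; uncurry)
open import Data.Rational.Base as ℚ using (ℚ; 0ℚ; ½)
import Data.Rational.Properties as ℚ
open import Data.Sum.Base using (_⊎_; inj₁; inj₂)
open import Function.Base using (_∘_; id)
open import Level using (0ℓ)
open import Relation.Binary.Bundles using (DecTotalOrder)
open import Relation.Binary.Core using (Rel)
open import Relation.Binary.Definitions using (Decidable; Irreflexive; Symmetric)
open import Relation.Binary.PropositionalEquality using (_≡_; _≢_; refl; sym; trans; cong; subst)
open import Relation.Nullary.Decidable using (Dec; yes; no; does; map′; ¬?; _×-dec_; _⊎-dec_)
open import Relation.Nullary.Negation using (¬_; contradiction)
import Relation.Unary as Unary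

infixr 8 _^ℚ_
_^ℚ_ : ℚ → ℕ → ℚ
_^ℚ_ = _^_ ℚ.+-*-rawSemiring

∑ : ∀ {n} → (Fin n → ℚ) → ℚ
∑ = sum ℚ.+-0-rawMonoid

record Graph (n : ℕ) : Set₁ where
  field
    Adj    : Rel (Fin n) 0ℓ
    symm   : Symmetric Adj
    irrefl : Irreflexive _≡_ Adj
    adj?   : Decidable Adj

open Graph

module _ {n} (G : Graph n) where

  infixr 5 _∷_

  data Walk : ℕ → Fin n → Fin n → Set where
    []  : ∀ {i} → Walk 0 i i
    _∷_ : ∀ {l i j k} → Adj G i k → Walk l k j → Walk (suc l) i j

  walk? : ∀ l i j → Dec (Walk l i j)
  walk? zero    i j = map′ (λ { refl → [] }) (λ { [] → refl }) (i ≟ j)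
  walk? (suc l) i j = map′ (λ { (_ , a , w) → a ∷ w }) (λ { (a ∷ w) → _ , a , w })
                           (any? λ k → adj? G i k ×-dec walk? l k j)

  -- The least length of a walk, or nothing if the vertices lie in different
  -- components.  Searching the lengths below n is enough: see dist-correct.
  dist : Fin n → Fin n → Maybe ℕ
  dist i j = find (λ l → walk? l i j) (upTo n)

  IsDistance : Fin n → Fin n → Maybe ℕ → Set
  IsDistance i j (just d) = Walk d i j × (∀ l → Walk l i j → d ≤ l)
  IsDistance i j nothing  = ∀ l → ¬ Walk l i j

2^-_ : Maybe ℕ → ℚ
2^- just d  = ½ ^ℚ d
2^- nothing = 0ℚ

closeness : ∀ {n} → Graph n → ℚ
closeness G = ∑ λ i → ∑ λ j → if does (i ≟ j) then 0ℚ else 2^- dist G i j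

SameLink : ∀ {n} → Fin n → Fin n → Rel (Fin n) 0ℓ
SameLink r s i j = (i ≡ r × j ≡ s) ⊎ (i ≡ s × j ≡ r)

delete : ∀ {n} → Graph n → Fin n → Fin n → Graph n
delete G r s = record
  { Adj    = λ i j → Adj G i j × ¬ SameLink r s i j
  ; symm   = λ (a , ¬rs) → symm G a , ¬rs ∘ λ
      { (inj₁ (p , q)) → inj₂ (q , p) ; (inj₂ (p , q)) → inj₁ (q , p) }
  ; irrefl = λ eq (a , _) → irrefl G eq a
  ; adj?   = λ i j → adj? G i j ×-dec
      ¬? ((i ≟ r ×-dec j ≟ s) ⊎-dec (i ≟ s ×-dec j ≟ r))
  }

-- Each link occurs in both orientations, which does not affect a minimum.
links : ∀ {n} → Graph n → List (Fin n × Fin n)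
links {n} G = filter (uncurry (adj? G)) (cartesianProduct (allFin n) (allFin n))

minimum : List ℚ → Maybe ℚ
minimum []       = nothing
minimum (q ∷ qs) = just (min q qs)
  where open Data.List.Extrema (DecTotalOrder.totalOrder ℚ.≤-decTotalOrder) using (min)

-- The value is nothing exactly when the graph has no links.
linkResidualCloseness : ∀ {n} → Graph n → Maybe ℚ
linkResidualCloseness G =
  minimum (map (λ (r , s) → closeness (delete G r s)) (links G))

infix 4 _≡_[mod_]
_≡_[mod_] : ℤ → ℤ → ℕ → Set
a ≡ b [mod m ] = + m ∣ a ℤ.- b

steps : ℕ → List ℤ
steps n = + 1 ∷ -[1+ 0 ] ∷ + 2 ∷ -[1+ 1 ] ∷ + n ∷ []

HararyAdj : ∀ n → Rel (Fin (2 ℕ.* n)) 0ℓ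
HararyAdj n i j =
  i ≢ j × Any (λ c → + toℕ i ℤ.- + toℕ j ≡ c [mod 2 ℕ.* n ]) (steps n)

private
  neg : ∀ {m a b} c → + m ∣ (a ℤ.- b) ℤ.- c → + m ∣ (b ℤ.- a) ℤ.- (ℤ.- c)
  neg {m} {a} {b} c (divides q eq) = divides (ℤ.- q)
    (trans (lemma₁ a b c) (trans (cong ℤ.-_ eq) (lemma₂ q (+ m))))
    where
    lemma₁ : ∀ a b c → (b ℤ.- a) ℤ.- (ℤ.- c) ≡ ℤ.- ((a ℤ.- b) ℤ.- c)
    lemma₁ = solve-∀
    lemma₂ : ∀ q m → ℤ.- (q ℤ.* m) ≡ (ℤ.- q) ℤ.* m
    lemma₂ = solve-∀

  neg-half : ∀ {m a b} c → m ≡ + 2 ℤ.* c → m ∣ (a ℤ.- b) ℤ.- c → m ∣ (b ℤ.- a) ℤ.- c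
  neg-half {_} {a} {b} c refl (divides q eq) = divides (ℤ.- q ℤ.- + 1)
    (trans (lemma₁ a b c)
      (trans (cong (λ x → ℤ.- x ℤ.- (+ 2 ℤ.* c)) eq) (lemma₂ q c)))
    where
    lemma₁ : ∀ a b c → (b ℤ.- a) ℤ.- c ≡ ℤ.- ((a ℤ.- b) ℤ.- c) ℤ.- (+ 2 ℤ.* c)
    lemma₁ = solve-∀
    lemma₂ : ∀ q c → ℤ.- (q ℤ.* (+ 2 ℤ.* c)) ℤ.- (+ 2 ℤ.* c) ≡ (ℤ.- q ℤ.- + 1) ℤ.* (+ 2 ℤ.* c)
    lemma₂ = solve-∀

  steps-symm : ∀ {a b} n →
    Any (λ c → a ℤ.- b ≡ c [mod 2 ℕ.* n ]) (steps n) →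
    Any (λ c → b ℤ.- a ≡ c [mod 2 ℕ.* n ]) (steps n)
  steps-symm {a} {b} n (here p)                         = there (here (neg {_} {a} {b} (+ 1) p))
  steps-symm {a} {b} n (there (here p))                 = here (neg {_} {a} {b} -[1+ 0 ] p)
  steps-symm {a} {b} n (there (there (here p)))         = there (there (there (here (neg {_} {a} {b} (+ 2) p))))
  steps-symm {a} {b} n (there (there (there (here p)))) = there (there (here (neg {_} {a} {b} -[1+ 1 ] p)))
  steps-symm {a} {b} n (there (there (there (there (here p))))) =
    there (there (there (there (here (neg-half {_} {a} {b} (+ n) (ℤ.pos-* 2 n) p)))))

-- H₅,₂ₙ, the Harary graph of the literature for n ≥ 3.  Vertices are numbered
-- from 0 rather than from 1, which leaves the differences i - j unchanged.
harary₅ : ∀ n → Graph (2 ℕ.* n)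
harary₅ n = record
  { Adj    = HararyAdj n
  ; symm   = λ {i} {j} (i≢j , p) → i≢j ∘ sym , steps-symm {+ toℕ i} {+ toℕ j} n p
  ; irrefl = λ i≡j (i≢j , _) → i≢j i≡j
  ; adj?   = λ i j → ¬? (i ≟ j) ×-dec
      Any.any? (λ c → + (2 ℕ.* n) ∣? (+ toℕ i ℤ.- + toℕ j) ℤ.- c) (steps n)
  }

module _ {n} (G : Graph n) where

  private
    vertex : ∀ {l i j} → Walk G l i j → Fin (suc l) → Fin n
    vertex {i = i} _       zero    = i
    vertex         (_ ∷ w) (suc a) = vertex w a

    take : ∀ {l i j} (w : Walk G l i j) a → Walk G (toℕ a) i (vertex w a)
    take w       zero    = []
    take (e ∷ w) (suc a) = e ∷ take w a

    drop : ∀ {l i j} (w : Walk G l i j) a → Walk G (l ∸ toℕ a) (vertex w a) j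
    drop w       zero    = w
    drop (_ ∷ w) (suc a) = drop w a

    _++_ : ∀ {l m i j k} → Walk G l i j → Walk G m j k → Walk G (l ℕ.+ m) i k
    []      ++ v = v
    (e ∷ w) ++ v = e ∷ (w ++ v)

    shorten : ∀ {l i j} → n ≤ l → Walk G l i j → ∃[ m ] m < l × Walk G m i j
    shorten {l} {i} {j} n≤l w with pigeonhole (s≤s n≤l) (vertex w)
    ... | a , b , a<b , eq =
      toℕ a ℕ.+ (l ∸ toℕ b)
      , ℕ.<-≤-trans (ℕ.+-monoˡ-< (l ∸ toℕ b) a<b) (ℕ.≤-reflexive (ℕ.m+[n∸m]≡n (toℕ≤pred[n] b)))
      , take w a ++ subst (λ v → Walk G (l ∸ toℕ b) v j) (sym eq) (drop w b)

    bounded : ∀ {i j} l → Walk G l i j → ∃[ m ] m < n × Walk G m i j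
    bounded {i} {j} = <-rec _ λ l rec w → step l rec w (l ℕ.<? n)
      where
      step : ∀ l → (∀ {m} → m < l → Walk G m i j → ∃[ k ] k < n × Walk G k i j) →
             Walk G l i j → Dec (l < n) → ∃[ k ] k < n × Walk G k i j
      step l rec w (yes l<n) = l , l<n , w
      step l rec w (no  l≮n) with shorten (ℕ.≮⇒≥ l≮n) w
      ... | m , m<l , v = rec m<l v

  private module _ {P : Unary.Pred ℕ 0ℓ} (P? : Unary.Decidable P) where

    FirstIn : (ℕ → ℕ) → ℕ → Maybe ℕ → Set
    FirstIn f m (just d) = ∃[ a ] f a ≡ d × P d × (∀ b → P (f b) → a ≤ b)
    FirstIn f m nothing  = ∀ b → b < m → ¬ P (f b)

    find-first : ∀ f m → FirstIn f m (find P? (applyUpTo f m))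
    find-first f zero    = λ _ ()
    find-first f (suc m) with P? (f 0)
    ... | yes p = 0 , refl , p , λ _ _ → z≤n
    ... | no ¬p with find P? (applyUpTo (f ∘ suc) m) | find-first (f ∘ suc) m
    ...   | just d  | a , eq , p , least = suc a , eq , p , λ
      { zero q → contradiction q ¬p ; (suc b) q → s≤s (least b q) }
    ...   | nothing | none = λ { zero _ → ¬p ; (suc b) (s≤s b<m) → none b b<m }

  dist-correct : ∀ i j → IsDistance G i j (dist G i j)
  dist-correct i j with dist G i j | find-first (λ l → walk? G l i j) id n
  ... | just d  | _ , refl , w , least = w , least
  ... | nothing | none = λ l w → let (_ , m<n , v) = bounded l w in none _ m<n v

{-# OPTIONS --safe #-}

-- The links of H₅,₂ₙ are the steps ±1, ±2 and n around a circle of length 2n,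
-- so a walk of length l amounts to an arc of y ≤ (n + 1) / 2 and ε ≤ 1
-- diameters with y + 2ε ≤ 2l.  Up to this normal form the moves commute, which
-- usually leaves a rearrangement of the walk that avoids a given link.  After
-- deleting a step 1 or a diameter, the only pair that becomes more distant is
-- formed by the ends of the link, which costs at most 3/4 in total.  After
-- deleting the step {r , r + 2}, the arcs of m ≤ k double steps through it have
-- no other geodesic.  These m arcs for each m are prolonged by exactly 1, which
-- costs 2 Σ m 2^-(m+1) = 2 - (k+2) 2^-k, at least 1 since n ≥ 7 gives k ≥ 2.

module Submission where

open import Defs
import Algebra.Properties.CommutativeMonoid.Sum as CMSum
open import Data.Bool.Base using (if_then_else_; true; false)
open import Data.Empty using (⊥; ⊥-elim)
open import Data.Fin.Base as Fin using (Fin; zero; suc; toℕ)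
import Data.Fin.Properties as Fin
open import Data.Integer.Base as ℤ using (+_; -[1+_])
import Data.Integer.Properties as ℤ
open import Data.Integer.Divisibility.Signed as ℤ using (divides)
import Data.Integer.Tactic.RingSolver as ℤ-Solver
open import Data.List.Base using (_∷_; map; allFin; cartesianProduct)
import Data.List.Extrema
open import Data.List.Membership.Propositional using (_∈_)
open import Data.List.Membership.Propositional.Properties
  using (∈-map⁺; ∈-filter⁺; ∈-cartesianProduct⁺; ∈-allFin)
open import Data.List.Relation.Unary.All as All using (All; []; _∷_)
import Data.List.Relation.Unary.All.Properties as All
open import Data.List.Relation.Unary.Any as Any using (Any; here; there)
open import Data.Maybe.Base using (just; nothing)
open import Data.Nat.Base as ℕ using (ℕ; zero; suc; _≤_; _<_; z≤n; s≤s; NonZero)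
import Data.Nat.Properties as ℕ
open import Data.Nat.DivMod
  using ( _%_; m%n<n; m≡m%n+[m/n]*n; [m+n]%n≡m%n; [m+kn]%n≡m%n; %-distribˡ-+; m<n⇒m%n≡m
        ; m∣n⇒o%n%m≡o%m; /-monoˡ-≤; m/n*n≤m; m*n/n≡m )
  renaming (_/_ to _div_)
open import Data.Nat.Divisibility using (m∣m*n)
open import Data.Nat.Induction using (<-rec)
open import Data.Nat.Tactic.RingSolver using (solve-∀)
open import Data.Product.Base using (_×_; _,_; ∃-syntax; proj₁; proj₂; uncurry)
open import Data.Sum.Base as Sum using (_⊎_; inj₁; inj₂; swap)
open import Function.Base using (_∋_; _∘_)
open import Relation.Binary.Bundles using (DecTotalOrder)
open import Relation.Binary.PropositionalEquality
open import Relation.Nullary.Decidable using (Dec; does; dec-true; dec-false; _×-dec_; yes; no)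
open import Relation.Nullary.Negation using (¬_; contradiction)

open Graph

-- Two orders of the same moves suffice to dodge a deleted step 2. With an odd arc, a unit step at
-- the front or at the back puts the double steps on vertices of opposite parity, and parity is well
-- defined because 2n is even. With a diameter, the double steps run on one side of the circle or on
-- the opposite one, and the bound on y keeps these two runs from both meeting the link. Only an arc
-- of double steps alone has nothing to move, and there the bound reads 4m ≤ n + 1, whence k. The
-- lower bound for such a pair after the deletion needs more than the normal form, which forgets the
-- links of a walk. So the translation of a walk keeps them in the one case that matters, a walk of
-- forward double steps only. An arc may be run in either direction. Swapping the ends of the pair
-- leaves only forward arcs, and the same symmetry doubles every loss counted in one orientation.

module _ {n} (G : Graph n) where

  infixr 5 _++_

  _++_ : ∀ {l m i j k} → Walk G l i j → Walk G m j k → Walk G (l ℕ.+ m) i k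
  []      ++ v = v
  (e ∷ w) ++ v = e ∷ (w ++ v)

  reverse : ∀ {l i j} → Walk G l i j → Walk G l j i
  reverse []      = []
  reverse {suc l} {i} {j} (e ∷ w) = subst (λ m → Walk G m j i) (ℕ.+-comm l 1)
    (reverse w ++ (Graph.symm G e ∷ []))

-- The summand c cancels, s is slack, and both equations are semiring identities.
linear : ∀ {x y a b} c s → x ≤ y → x ≡ a ℕ.+ s ℕ.+ c → y ≡ b ℕ.+ c → a ≤ b
linear {a = a} {b} c s x≤y refl refl =
  ℕ.≤-trans (ℕ.m≤m+n a s) (ℕ.+-cancelʳ-≤ c (a ℕ.+ s) b x≤y)

absurd : ∀ {x y} s → x ≤ y → x ≡ suc (y ℕ.+ s) → ⊥
absurd {y = y} s x≤y refl = ℕ.m+1+n≰m y (ℕ.≤-trans (ℕ.≤-reflexive (ℕ.+-suc y s)) x≤y)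

module Circulant (n : ℕ) (7≤n : 7 ≤ n) where

  open import Data.Nat.Base using (_+_; _*_; _∸_; ⌈_/2⌉)

  -- Vertices as residues modulo 2n

  N : ℕ
  N = 2 * n

  instance
    N≢0 : NonZero N
    N≢0 = ℕ.>-nonZero (ℕ.≤-trans (s≤s z≤n) (ℕ.≤-trans 7≤n (ℕ.m≤m+n n (n + 0))))

  -- Positions are naturals of any size, so that moves add up without reduction and a congruence
  -- modulo `N` is an equality of vertices.
  V : ℕ → Fin N
  V a = Fin.fromℕ< (m%n<n a N)

  toℕ-V : ∀ a → toℕ (V a) ≡ a % N
  toℕ-V a = Fin.toℕ-fromℕ< (m%n<n a N)

  V-% : ∀ {a b} → V a ≡ V b → a % N ≡ b % N
  V-% {a} {b} eq = trans (sym (toℕ-V a)) (trans (cong toℕ eq) (toℕ-V b))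

  %-V : ∀ {a b} → a % N ≡ b % N → V a ≡ V b
  %-V {a} {b} eq = Fin.toℕ-injective (trans (toℕ-V a) (trans eq (sym (toℕ-V b))))

  V-toℕ : ∀ i → V (toℕ i) ≡ i
  V-toℕ i = Fin.toℕ-injective (trans (toℕ-V (toℕ i)) (m<n⇒m%n≡m (Fin.toℕ<n i)))

  V-wrap : ∀ a k → V (a + k * N) ≡ V a
  V-wrap a k = %-V ([m+kn]%n≡m%n a k N)

  V-turn : ∀ a → V (a + n + n) ≡ V a
  V-turn a = trans (cong V (((∀ a n → a + n + n ≡ a + 1 * (2 * n)) ∋ solve-∀) a n)) (V-wrap a 1)

  V-+ : ∀ {a b} c → V a ≡ V b → V (a + c) ≡ V (b + c)
  V-+ {a} {b} c eq = %-V (trans (%-distribˡ-+ a c N)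
    (trans (cong (λ x → (x + c % N) % N) (V-% eq)) (sym (%-distribˡ-+ b c N))))

  -- Adding c (N - 1) completes c to c N, a multiple of the period.
  V-cancel : ∀ {a b} c → V (a + c) ≡ V (b + c) → V a ≡ V b
  V-cancel {a} {b} c eq = trans (sym (fill a)) (trans (V-+ (c * (N ∸ 1)) eq) (fill b))
    where
    fill : ∀ a → V (a + c + c * (N ∸ 1)) ≡ V a
    fill a = trans (cong V (trans (ℕ.+-assoc a c _) (cong (λ x → a + x)
      (trans (sym (ℕ.*-suc c (N ∸ 1))) (cong (c *_) (ℕ.suc-pred N)))))) (V-wrap a c)

  V-inj : ∀ {c d} a → c < N → d < N → V (a + c) ≡ V (a + d) → c ≡ d
  V-inj {c} {d} a c<N d<N eq = trans (sym (m<n⇒m%n≡m c<N)) (trans (V-% (V-cancel {c} {d} a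
    (trans (cong V (ℕ.+-comm c a)) (trans eq (cong V (ℕ.+-comm a d)))))) (m<n⇒m%n≡m d<N))

  V-≢ : ∀ a {d} → 0 < d → d < N → V a ≢ V (a + d)
  V-≢ a {d} 0<d d<N eq = ℕ.<⇒≢ 0<d
    (V-inj a (ℕ.<-trans 0<d d<N) d<N (trans (cong V (ℕ.+-identityʳ a)) eq))

  -- The period is even, so the parity of a position depends only on its vertex. Runs of double
  -- steps from positions of different parity therefore share no vertex.
  V-parity : ∀ {a b} → V a ≡ V b → a % 2 ≡ b % 2
  V-parity {a} {b} eq = trans (sym (m∣n⇒o%n%m≡o%m 2 N a (m∣m*n n)))
    (trans (cong (_% 2) (V-% eq)) (m∣n⇒o%n%m≡o%m 2 N b (m∣m*n n)))

  ∣⇒V : ∀ {a b} → (+ N) ℤ.∣ (+ a ℤ.- + b) → V a ≡ V b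
  ∣⇒V {a} {b} (divides (+ k) eq) = trans (cong V (ℤ.+-injective a≡)) (V-wrap b k)
    where
    back : ∀ x y → x ≡ y ℤ.+ (x ℤ.- y)
    back = ℤ-Solver.solve-∀
    a≡ : + a ≡ + (b + k * N)
    a≡ = trans (back (+ a) (+ b))
      (cong (λ x → + b ℤ.+ x) (trans eq (sym (ℤ.pos-* k N))))
  ∣⇒V {a} {b} (divides -[1+ k ] eq) = sym (trans (cong V (ℤ.+-injective b≡)) (V-wrap a (suc k)))
    where
    back : ∀ x y → y ≡ x ℤ.- (x ℤ.- y)
    back = ℤ-Solver.solve-∀
    b≡ : + b ≡ + (a + suc k * N)
    b≡ = trans (back (+ a) (+ b))
      (cong (λ x → + a ℤ.+ x) (trans (cong ℤ.-_ eq)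
          (trans (ℤ.neg-distribˡ-* -[1+ k ] (+ N)) (sym (ℤ.pos-* (suc k) N)))))

  V⇒∣ : ∀ {a b} → V a ≡ V b → (+ N) ℤ.∣ (+ a ℤ.- + b)
  V⇒∣ {a} {b} eq = divides (+ (a div N) ℤ.- + (b div N)) (trans (cong₂ ℤ._-_ (split a)
    (trans (split b) (cong (λ r → + r ℤ.+ + (b div N) ℤ.* + N) (sym (V-% eq)))))
    (ident (+ (a % N)) (+ (a div N)) (+ (b div N)) (+ N)))
    where
    split : ∀ a → + a ≡ + (a % N) ℤ.+ + (a div N) ℤ.* + N
    split a = trans (cong +_ (m≡m%n+[m/n]*n a N))
        (cong (λ x → + (a % N) ℤ.+ x) (ℤ.pos-* (a div N) N))
    ident : ∀ r p q m → (r ℤ.+ p ℤ.* m) ℤ.- (r ℤ.+ q ℤ.* m) ≡ (p ℤ.- q) ℤ.* m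
    ident = ℤ-Solver.solve-∀

  -- Normal forms of walks

  H₅ : Graph (2 * n)
  H₅ = harary₅ n

  -- Backward steps are read from their other end, so that three lengths cover the five residues in
  -- `steps`.
  data Step : ℕ → Set where
    one  : Step 1
    two  : Step 2
    half : Step n

  0<step : ∀ {d} → Step d → 0 < d
  0<step one  = s≤s z≤n
  0<step two  = s≤s z≤n
  0<step half = ℕ.≤-trans (s≤s z≤n) 7≤n

  n+n≡N : n + n ≡ N
  n+n≡N = cong (λ x → n + x) (sym (ℕ.+-identityʳ n))

  n<N : n < N
  n<N = ℕ.≤-trans (ℕ.+-monoˡ-≤ n (0<step half)) (ℕ.≤-reflexive n+n≡N)

  step<N : ∀ {d} → Step d → d < N
  step<N one  = ℕ.≤-<-trans (0<step half) n<N
  step<N two  = ℕ.≤-<-trans (ℕ.≤-trans (s≤s (s≤s z≤n)) 7≤n) n<N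
  step<N half = n<N

  private
    diff⁺ : ∀ x y d → (+ x ℤ.- + y) ℤ.- + d ≡ + x ℤ.- + (y + d)
    diff⁺ x y d = ident (+ x) (+ y) (+ d)
      where
      ident : ∀ x y d → (x ℤ.- y) ℤ.- d ≡ x ℤ.- (y ℤ.+ d)
      ident = ℤ-Solver.solve-∀

    diff⁻ : ∀ x y d → (+ x ℤ.- + y) ℤ.- (ℤ.- + d) ≡ + (x + d) ℤ.- + y
    diff⁻ x y d = ident (+ x) (+ y) (+ d)
      where
      ident : ∀ x y d → (x ℤ.- y) ℤ.- (ℤ.- d) ≡ (x ℤ.+ d) ℤ.- y
      ident = ℤ-Solver.solve-∀

  step-link : ∀ {d} a → Step d → Adj H₅ (V a) (V (a + d))
  step-link {d} a s = symm H₅ {V (a + d)} {V a}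
      (V-≢ a (0<step s) (step<N s) ∘ sym , mem (+ toℕ (V (a + d)) ℤ.- + toℕ (V a)) s cong⁺)
    where
    mem : ∀ {d} z → Step d → + N ℤ.∣ z ℤ.- + d → Any (λ c → z ≡ c [mod N ]) (steps n)
    mem _ one  p = here p
    mem _ two  p = there (there (here p))
    mem _ half p = there (there (there (there (here p))))
    cong⁺ : + N ℤ.∣ (+ toℕ (V (a + d)) ℤ.- + toℕ (V a)) ℤ.- + d
    cong⁺ = subst (+ N ℤ.∣_) (sym (diff⁺ (toℕ (V (a + d))) (toℕ (V a)) d))
      (V⇒∣ (trans (V-toℕ (V (a + d))) (V-+ {a} {toℕ (V a)} d (sym (V-toℕ (V a))))))

  step-from-link : ∀ {i j} → Adj H₅ i j → ∃[ d ] Step d × (j ≡ V (toℕ i + d) ⊎ i ≡ V (toℕ j + d))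
  step-from-link {i} {j} (_ , here p) = 1 , one , inj₂ (trans (sym (V-toℕ i))
    (∣⇒V (subst (+ N ℤ.∣_) (diff⁺ (toℕ i) (toℕ j) 1) p)))
  step-from-link {i} {j} (_ , there (here p)) = 1 , one , inj₁ (trans (sym (V-toℕ j))
    (sym (∣⇒V (subst (+ N ℤ.∣_) (diff⁻ (toℕ i) (toℕ j) 1) p))))
  step-from-link {i} {j} (_ , there (there (here p))) = 2 , two , inj₂ (trans (sym (V-toℕ i))
    (∣⇒V (subst (+ N ℤ.∣_) (diff⁺ (toℕ i) (toℕ j) 2) p)))
  step-from-link {i} {j} (_ , there (there (there (here p)))) = 2 , two , inj₁
      (trans (sym (V-toℕ j))
    (sym (∣⇒V (subst (+ N ℤ.∣_) (diff⁻ (toℕ i) (toℕ j) 2) p))))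
  step-from-link {i} {j} (_ , there (there (there (there (here p))))) = n , half , inj₂
      (trans (sym (V-toℕ i))
    (∣⇒V (subst (+ N ℤ.∣_) (diff⁺ (toℕ i) (toℕ j) n) p)))

  -- From V a to V b by p unit moves forward, q unit moves backward and ε diameters.
  record Route (l a b : ℕ) : Set where
    constructor route
    field
      p q ε  : ℕ
      ε≤1    : ε ≤ 1
      meets  : V (a + p + ε * n) ≡ V (b + q)
      length : p + q + 2 * ε ≤ 2 * l

  -- `straight` stands for forward double steps only and keeps their links in `H`, one of which may
  -- be the deleted one. Any other step holds the forward count strictly below `2 * l`, and this
  -- strictness is what refutes `bent` in `shape-rigid`.
  data Shape (H : Graph (2 * n)) (l a b : ℕ) : Set where
    straight : V (a + 2 * l) ≡ V b →
               (∀ c → c < l → Adj H (V (a + 2 * c)) (V (a + 2 * c + 2))) → Shape H l a b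
    bent     : (r : Route l a b) → Route.p r < 2 * l → Shape H l a b

  shape⇒route : ∀ {H l a b} → Shape H l a b → Route l a b
  shape⇒route {l = l} {a} {b} (straight eq _) = route (2 * l) 0 0 z≤n
    (trans (cong V (ℕ.+-identityʳ _)) (trans eq (cong V (sym (ℕ.+-identityʳ b)))))
    (ℕ.≤-reflexive (trans (ℕ.+-identityʳ _) (ℕ.+-identityʳ _)))
  shape⇒route (bent r _) = r

  p≤2l : ∀ {l a b} (r : Route l a b) → Route.p r ≤ 2 * l
  p≤2l (route p q ε _ _ length) = ℕ.m+n≤o⇒m≤o p (ℕ.m+n≤o⇒m≤o (p + q) length)

  2*-suc : ∀ l → 2 * suc l ≡ 2 + 2 * l
  2*-suc = solve-∀

  shift : ∀ {a b} c {x y} → V a ≡ V b → a + c ≡ x → b + c ≡ y → V x ≡ V y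
  shift c eq refl refl = V-+ c eq

  module _ {H : Graph (2 * n)} where

    forward-one : ∀ {l a a′ b} → V a′ ≡ V (a + 1) → Route l a′ b → Shape H (suc l) a b
    forward-one {l} {a} {a′} {b} eq r@(route p q ε ε≤1 meets length) = bent
      (route (1 + p) q ε ε≤1
        (trans (shift (p + ε * n) (sym eq)
          (((∀ a p e → a + 1 + (p + e) ≡ a + (1 + p) + e) ∋ solve-∀) a p (ε * n))
          (sym (ℕ.+-assoc a′ p (ε * n)))) meets)
        (ℕ.≤-trans (ℕ.+-mono-≤ (ℕ.≤-refl {1}) length) (linear 0 1 ℕ.≤-refl
          (((∀ l → 2 * suc l ≡ 1 + 2 * l + 1 + 0) ∋ solve-∀) l) (sym (ℕ.+-identityʳ _)))))
      (subst (1 + p <_) (sym (2*-suc l)) (s≤s (s≤s (p≤2l r))))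

    forward-two : ∀ {l a b} → Adj H (V a) (V (a + 2)) → Shape H l (a + 2) b → Shape H (suc l) a b
    forward-two {l} {a} {b} e (straight eq es) = straight
      (trans (cong V (((∀ a l → a + 2 * suc l ≡ a + 2 + 2 * l) ∋ solve-∀) a l)) eq)
      λ { zero _ → subst (λ x → Adj H (V x) (V (x + 2))) (sym (ℕ.+-identityʳ a)) e
        ; (suc c) (s≤s c<l) → subst (λ x → Adj H (V x) (V (x + 2)))
            (((∀ a c → a + 2 + 2 * c ≡ a + 2 * suc c) ∋ solve-∀) a c) (es c c<l) }
    forward-two {l} {a} {b} e (bent r@(route p q ε ε≤1 meets length) p<2l) = bent
      (route (2 + p) q ε ε≤1
        (trans (cong V (((∀ a p e → a + (2 + p) + e ≡ a + 2 + p + e) ∋ solve-∀) a p (ε * n))) meets)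
        (subst (2 + p + q + 2 * ε ≤_) (sym (2*-suc l)) (s≤s (s≤s length))))
      (subst (2 + p <_) (sym (2*-suc l)) (s≤s (s≤s p<2l)))

    backward : ∀ {l a a′ b d} → d ≤ 2 → V a ≡ V (a′ + d) → Route l a′ b → Shape H (suc l) a b
    backward {l} {a} {a′} {b} {d} d≤2 eq r@(route p q ε ε≤1 meets length) = bent
      (route p (q + d) ε ε≤1
        (trans (shift (p + ε * n) eq (sym (ℕ.+-assoc a p (ε * n)))
          (((∀ a d p e → a + d + (p + e) ≡ a + p + e + d) ∋ solve-∀) a′ d p (ε * n)))
          (shift d meets refl (ℕ.+-assoc b q d)))
        (linear 0 0 (ℕ.+-mono-≤ d≤2 length)
          (((∀ p q d e → d + (p + q + 2 * e) ≡ p + (q + d) + 2 * e + 0 + 0) ∋ solve-∀) p q d ε)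
          (((∀ l → 2 + 2 * l ≡ 2 * suc l + 0) ∋ solve-∀) l)))
      (ℕ.≤-<-trans (p≤2l r) (ℕ.*-monoʳ-< 2 (ℕ.n<1+n l)))

    across : ∀ {l a a′ b} → V a ≡ V (a′ + n) → Route l a′ b → Shape H (suc l) a b
    across {l} {a} {a′} {b} eq r@(route p q zero ε≤1 meets length) = bent
      (route p q 1 (s≤s z≤n)
        (trans (shift (p + 1 * n) eq (sym (ℕ.+-assoc a p (1 * n)))
          (((∀ a n p → a + n + (p + 1 * n) ≡ a + p + 0 + n + n) ∋ solve-∀) a′ n p))
          (trans (V-turn (a′ + p + 0)) meets))
        (linear 0 0 (ℕ.+-mono-≤ (ℕ.≤-refl {2}) length)
          (((∀ p q → 2 + (p + q + 2 * 0) ≡ p + q + 2 * 1 + 0 + 0) ∋ solve-∀) p q)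
          (((∀ l → 2 + 2 * l ≡ 2 * suc l + 0) ∋ solve-∀) l)))
      (ℕ.≤-<-trans (p≤2l r) (ℕ.*-monoʳ-< 2 (ℕ.n<1+n l)))
    -- The new diameter cancels the one in the rest of the walk.
    across {l} {a} {a′} {b} eq r@(route p q (suc zero) ε≤1 meets length) = bent
      (route p q 0 z≤n
        (trans (shift p eq (sym (ℕ.+-identityʳ (a + p)))
          (((∀ a n p → a + n + p ≡ a + p + 1 * n) ∋ solve-∀) a′ n p)) meets)
        (linear 0 4 (ℕ.+-mono-≤ (ℕ.≤-refl {2}) length)
          (((∀ p q → 2 + (p + q + 2 * 1) ≡ p + q + 2 * 0 + 4 + 0) ∋ solve-∀) p q)
          (((∀ l → 2 + 2 * l ≡ 2 * suc l + 0) ∋ solve-∀) l)))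
      (ℕ.≤-<-trans (p≤2l r) (ℕ.*-monoʳ-< 2 (ℕ.n<1+n l)))
    across eq (route p q (suc (suc ε)) (s≤s ()) meets length)

  -- Stated for every subgraph of `H₅`: for the whole graph it bounds distances, for a deletion it
  -- exposes the links that a straight walk must use.
  walk-shape : ∀ {H l i j a b} → (∀ {i j} → Adj H i j → Adj H₅ i j) →
               Walk H l i j → V a ≡ i → V b ≡ j → Shape H l a b
  walk-shape {a = a} sub [] refl eq = straight (trans (cong V (ℕ.+-identityʳ a)) (sym eq)) λ _ ()
  walk-shape {H} {suc l} {i} {j} {a} {b} sub (_∷_ {k = k} e w) refl refl with step-from-link (sub e)
  ... | 1 , one , inj₁ refl = forward-one {a′ = toℕ (V a) + 1}
    (V-+ {toℕ (V a)} 1 (V-toℕ (V a)))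
    (shape⇒route (walk-shape sub w refl refl))
  ... | 1 , one , inj₂ eq = backward (s≤s z≤n) eq
    (shape⇒route (walk-shape sub w (V-toℕ k) refl))
  ... | 2 , two , inj₁ refl = forward-two (subst (Adj H (V a)) k≡ e)
    (walk-shape sub w (sym k≡) refl)
    where k≡ = V-+ {toℕ (V a)} {a} 2 (V-toℕ (V a))
  ... | 2 , two , inj₂ eq = backward ℕ.≤-refl eq
    (shape⇒route (walk-shape sub w (V-toℕ k) refl))
  ... | _ , half , inj₁ refl = across
    (trans (sym (V-turn a)) (V-+ {a + n} {toℕ k} n
        (trans (sym (V-+ {toℕ (V a)} {a} n (V-toℕ (V a)))) (sym (V-toℕ k)))))
    (shape⇒route (walk-shape sub w (V-toℕ k) refl))
  ... | _ , half , inj₂ eq = across eq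
    (shape⇒route (walk-shape sub w (V-toℕ k) refl))

  -- By short, trading the arc for its complement and a diameter gains nothing.
  record Normal (l : ℕ) (i j : Fin (2 * n)) : Set where
    constructor normal
    field
      a y ε  : ℕ
      ε≤1    : ε ≤ 1
      start  : i ≡ V a
      end    : j ≡ V (a + y + ε * n)
      length : y + 2 * ε ≤ 2 * l
      short  : 2 * (y + ε) ≤ n + 1

  -- A long arc is exchanged for the complementary one and a diameter.
  normalise-arc : ∀ y {l i j} a {ε} → ε ≤ 1 → i ≡ V a → j ≡ V (a + y + ε * n) → y + 2 * ε ≤ 2 * l →
                  Normal l i j ⊎ Normal l j i
  normalise-arc = <-rec _ shrink
    where
    Goal : ℕ → Set
    Goal y = ∀ {l i j} a {ε} → ε ≤ 1 → i ≡ V a → j ≡ V (a + y + ε * n) → y + 2 * ε ≤ 2 * l →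
             Normal l i j ⊎ Normal l j i

    -- An arc of n units leads to the antipode. It is replaced by a diameter, which counts 2 instead
    -- of n, or cancels the diameter already present.
    reduce : ∀ o → Goal o → Goal (n + o)
    reduce o goal a {zero} _ i≡ j≡ length = goal a (s≤s z≤n) i≡
      (trans j≡ (cong V (((∀ a n o → a + (n + o) + 0 ≡ a + o + 1 * n) ∋ solve-∀) a n o)))
      (linear n 5 (ℕ.+-mono-≤ 7≤n length)
        (((∀ n o → 7 + (n + o + 2 * 0) ≡ o + 2 * 1 + 5 + n) ∋ solve-∀) n o) (ℕ.+-comm n _))
    reduce o goal {l} a {suc zero} _ i≡ j≡ length = goal a z≤n i≡
      (trans j≡ (trans
        (cong V (((∀ a n o → a + (n + o) + 1 * n ≡ a + o + 0 + n + n) ∋ solve-∀) a n o))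
        (V-turn (a + o + 0))))
      (linear 0 (n + 2) length (((∀ n o → n + o + 2 * 1 ≡ o + 0 + (n + 2) + 0) ∋ solve-∀) n o)
          (sym (ℕ.+-identityʳ _)))
    reduce o goal a {suc (suc ε)} (s≤s ())

    -- Going on from j by the remaining n - y units, and by a diameter if none was used yet,
    -- completes the full turn back to i. This is why the ends swap.
    flip : ∀ {y o} → y + o ≡ n → ∀ {l i j} a {ε} → n + 2 ≤ 2 * (y + ε) → ε ≤ 1 → i ≡ V a →
           j ≡ V (a + y + ε * n) → y + 2 * ε ≤ 2 * l → Normal l i j ⊎ Normal l j i
    flip {y} {o} y+o≡n {l} a {zero} long _ i≡ j≡ length = inj₂ (normal (a + y) o 1 (s≤s z≤n)
      (trans j≡ (cong V (ℕ.+-identityʳ _)))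
      (trans i≡ (trans (sym (V-turn a)) (cong V (trans (cong (λ x → a + x + n) (sym y+o≡n))
        (((∀ a y o n → a + (y + o) + n ≡ a + y + o + 1 * n) ∋ solve-∀) a y o n)))))
      (ℕ.≤-trans o+2≤y (ℕ.≤-trans (ℕ.m≤m+n y 0) length))
      (linear o 1 (ℕ.+-mono-≤ o+2≤y (ℕ.≤-refl {o + o + 1}))
        (((∀ o → o + 2 * 1 + (o + o + 1) ≡ 2 * (o + 1) + 1 + o) ∋ solve-∀) o)
        (trans (((∀ y o → y + (o + o + 1) ≡ (y + o) + 1 + o) ∋ solve-∀) y o)
            (cong (λ x → x + 1 + o) y+o≡n))))
      where
      o+2≤y : o + 2 * 1 ≤ y
      o+2≤y = linear y 0 long (trans (cong (_+ 2) (sym y+o≡n))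
          (((∀ y o → y + o + 2 ≡ o + 2 * 1 + 0 + y) ∋ solve-∀) y o))
        (((∀ y → 2 * (y + 0) ≡ y + y) ∋ solve-∀) y)
    flip {y} {o} y+o≡n {l} a {suc zero} long _ i≡ j≡ length = inj₂ (normal (a + y + n) o 0 z≤n
      (trans j≡ (cong V (cong (λ x → a + y + x) (ℕ.+-identityʳ n))))
      (trans i≡ (trans (sym (V-turn a)) (cong V (trans (cong (λ x → a + x + n) (sym y+o≡n))
        (((∀ a y o n → a + (y + o) + n ≡ a + y + n + o + 0) ∋ solve-∀) a y o n)))))
      (ℕ.≤-trans (ℕ.+-mono-≤ o≤y (z≤n {2})) length)
      (linear 0 1 (ℕ.+-mono-≤ o≤y (ℕ.≤-refl {o + 1}))
        (((∀ o → o + (o + 1) ≡ 2 * (o + 0) + 1 + 0) ∋ solve-∀) o)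
        (trans (((∀ y o → y + (o + 1) ≡ (y + o) + 1 + 0) ∋ solve-∀) y o)
            (cong (λ x → x + 1 + 0) y+o≡n))))
      where
      o≤y : o ≤ y
      o≤y = linear (y + 2) 0 long
          (trans (cong (_+ 2) (sym y+o≡n)) (((∀ y o → y + o + 2 ≡ o + 0 + (y + 2)) ∋ solve-∀) y o))
        (((∀ y → 2 * (y + 1) ≡ y + (y + 2)) ∋ solve-∀) y)
    flip _ a {suc (suc ε)} _ (s≤s ())

    shrink : ∀ y → (∀ {o} → o < y → Goal o) → Goal y
    shrink y rec a {ε} ε≤1 i≡ j≡ length with 2 * (y + ε) ℕ.≤? n + 1
    ... | yes short = inj₁ (normal a y ε ε≤1 i≡ j≡ length short)
    ... | no long with n ℕ.≤? y
    ...   | no n≰y with ℕ.m≤n⇒∃[o]m+o≡n (ℕ.<⇒≤ (ℕ.≰⇒> n≰y))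
    ...     | o , y+o≡n = flip y+o≡n a
        (subst (_≤ 2 * (y + ε)) (((∀ n → suc (n + 1) ≡ n + 2) ∋ solve-∀) n) (ℕ.≰⇒> long)) ε≤1 i≡ j≡
        length
    shrink y rec a ε≤1 i≡ j≡ length | no _ | yes n≤y with ℕ.m≤n⇒∃[o]m+o≡n n≤y
    ...     | o , refl = reduce o (rec (ℕ.m<n+m o (0<step half))) a ε≤1 i≡ j≡ length

  normalise : ∀ {l a b} → Route l a b → Normal l (V a) (V b) ⊎ Normal l (V b) (V a)
  normalise {l} {a} {b} (route p q ε ε≤1 meets length) with ℕ.≤-total q p
  ... | inj₁ q≤p = normalise-arc (p ∸ q) a ε≤1 refl (sym (V-cancel q (trans
      (cong V (trans (((∀ a y q e → a + y + e + q ≡ a + (y + q) + e) ∋ solve-∀) a (p ∸ q) q (ε * n))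
        (cong (λ x → a + x + ε * n) (ℕ.m∸n+n≡m q≤p)))) meets)))
    (ℕ.≤-trans (ℕ.+-monoˡ-≤ (2 * ε) (ℕ.≤-trans (ℕ.m∸n≤m p q) (ℕ.m≤m+n p q))) length)
  ... | inj₂ p≤q = swap (normalise-arc (q ∸ p) b ε≤1 refl
    (trans (sym (turns ε ε≤1)) (V-+ {a + ε * n} {b + (q ∸ p)} (ε * n) (V-cancel p
      (trans (cong V (((∀ a p e → a + e + p ≡ a + p + e) ∋ solve-∀) a p (ε * n)))
        (trans meets (cong V (trans (cong (λ x → b + x) (sym (ℕ.m∸n+n≡m p≤q)))
            (sym (ℕ.+-assoc b (q ∸ p) p)))))))))
    (ℕ.≤-trans (ℕ.+-monoˡ-≤ (2 * ε) (ℕ.≤-trans (ℕ.m∸n≤m q p) (ℕ.m≤n+m q p))) length))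
    where
    -- A diameter undoes itself, so `ε * n` may change sides in `meets` when the arc is measured
    -- from b.
    turns : ∀ ε → ε ≤ 1 → V (a + ε * n + ε * n) ≡ V a
    turns zero       _ = cong V (trans (ℕ.+-identityʳ (a + 0)) (ℕ.+-identityʳ a))
    turns (suc zero) _ = trans (cong V (((∀ a n → a + 1 * n + 1 * n ≡ a + n + n) ∋ solve-∀) a n))
        (V-turn a)
    turns (suc (suc _)) (s≤s ())

  walk-normal : ∀ {l i j} → Walk H₅ l i j → Normal l i j ⊎ Normal l j i
  walk-normal {l} {i} {j} w = subst₂ (λ i j → Normal l i j ⊎ Normal l j i) (V-toℕ i) (V-toℕ j)
    (normalise (shape⇒route (walk-shape {H₅} {a = toℕ i} {toℕ j} (λ e → e) w (V-toℕ i) (V-toℕ j))))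

  even-or-odd : ∀ y → ∃[ m ] (y ≡ 2 * m ⊎ y ≡ suc (2 * m))
  even-or-odd zero    = 0 , inj₁ refl
  even-or-odd (suc y) with even-or-odd y
  ... | m , inj₁ refl = m , inj₂ refl
  ... | m , inj₂ refl = suc m , inj₁ (sym (2*-suc m))

  suc-parity : ∀ b → suc b % 2 ≢ b % 2
  suc-parity zero    ()
  suc-parity (suc b) eq = suc-parity b
      (trans (sym eq) (trans (cong (_% 2) (ℕ.+-comm 2 b)) ([m+n]%n≡m%n b 2)))

  residue : ∀ b c → (b + 2 * c) % 2 ≡ b % 2
  residue b c = trans (cong (λ x → (b + x) % 2) (ℕ.*-comm 2 c)) ([m+kn]%n≡m%n b c 2)

  ⌈/2⌉≤ : ∀ {y l} → y ≤ 2 * l → ⌈ y /2⌉ ≤ l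
  ⌈/2⌉≤ {y} {l} y≤2l = ℕ.≤-trans (ℕ.⌈n/2⌉-mono y≤2l)
    (ℕ.≤-reflexive (trans (cong ⌈_/2⌉ (cong (λ x → l + x) (ℕ.+-identityʳ l)))
        (sym (ℕ.n≡⌈n+n/2⌉ l))))

  n≢1 : n ≢ 1
  n≢1 eq with subst (7 ≤_) eq 7≤n
  ... | s≤s ()

  n≢2 : n ≢ 2
  n≢2 eq with subst (7 ≤_) eq 7≤n
  ... | s≤s (s≤s ())

  step≤n : ∀ {d} → Step d → d ≤ n
  step≤n one  = ℕ.≤-trans (s≤s z≤n) 7≤n
  step≤n two  = ℕ.≤-trans (s≤s (s≤s z≤n)) 7≤n
  step≤n half = ℕ.≤-refl

  <half : ∀ {d} → Step d → d ≢ n → d < n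
  <half s d≢n = ℕ.≤∧≢⇒< (step≤n s) d≢n

  -- Walks that avoid a deleted link

  Reroute : Graph (2 * n) → ℕ → Fin (2 * n) → Fin (2 * n) → Set
  Reroute H l i j = ∃[ m ] m ≤ l × Walk H m i j

  to : ∀ {H k i x y} → x ≡ y → Walk H k i (V x) → Walk H k i (V y)
  to {H} {k} {i} eq = subst (λ x → Walk H k i (V x)) eq

  hop : ∀ {H} → (∀ a → Adj H (V a) (V (a + n))) → ∀ ε a → ε ≤ 1 → Walk H ε (V a) (V (a + ε * n))
  hop {H} half-ok zero       a _ = to {H} (sym (ℕ.+-identityʳ a)) []
  hop {H} half-ok (suc zero) a _ = to {H} (cong (λ x → a + x) (sym (ℕ.+-identityʳ n)))
      (half-ok a ∷ [])
  hop half-ok (suc (suc _)) a (s≤s ())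

  twos : ∀ {H} m a → (∀ c → c < m → Adj H (V (a + 2 * c)) (V (a + 2 * c + 2))) →
         Walk H m (V a) (V (a + 2 * m))
  twos {H} zero    a es = to {H} (sym (ℕ.+-identityʳ a)) []
  twos {H} (suc m) a es = subst (λ x → Adj H (V x) (V (x + 2))) (ℕ.+-identityʳ a) (es 0 (s≤s z≤n))
    ∷ to {H} (((∀ a m → a + 2 + 2 * m ≡ a + 2 * suc m) ∋ solve-∀) a m)
        (twos m (a + 2) λ c c<m → subst (λ x → Adj H (V x) (V (x + 2)))
          (((∀ a m → a + 2 * suc m ≡ a + 2 + 2 * m) ∋ solve-∀) a c) (es (suc c) (s≤s c<m)))

  ≤n+1⇒<N : ∀ {x} → x ≤ n + 1 → x < N
  ≤n+1⇒<N x≤ = ℕ.≤-<-trans x≤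
      (ℕ.<-≤-trans (ℕ.+-monoʳ-< n (ℕ.≤-trans (s≤s (s≤s z≤n)) 7≤n)) (ℕ.≤-reflexive n+n≡N))

  -- Up to half of the way to the antipode, the double steps are the only geodesic.
  shape-rigid : ∀ {H l m x} → 2 * (2 * m) ≤ n + 1 → l ≤ m → Shape H l x (x + 2 * m) →
                l ≡ m × (∀ c → c < l → Adj H (V (x + 2 * c)) (V (x + 2 * c + 2)))
  shape-rigid {H} {l} {m} {x} short l≤m (straight eq es) = ℕ.*-cancelˡ-≡ l m 2
      (V-inj x (bound l≤m) (bound ℕ.≤-refl) eq) , es
    where
    bound : ∀ {l} → l ≤ m → 2 * l < N
    bound l≤m = ≤n+1⇒<N (ℕ.≤-trans (ℕ.*-monoʳ-≤ 2 (ℕ.≤-trans l≤m (ℕ.m≤m+n m (m + 0)))) short)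
  shape-rigid {H} {l} {m} {x} short l≤m (bent (route p q ε ε≤1 meets length) p<2l)
    with ℕ.m≤n⇒∃[o]m+o≡n (ℕ.≤-trans (ℕ.<⇒≤ p<2l)
        (ℕ.≤-trans (ℕ.*-monoʳ-≤ 2 l≤m) (ℕ.m≤m+n (2 * m) q)))
  -- The unit moves fall short by z = 2m + q - p, which the ε diameters have to supply. But z = 0
  -- contradicts p < 2l, and z = n with ε = 1 contradicts z + 2ε ≤ n + 1.
  ... | z , p+z≡2m+q = ⊥-elim
      (conclude ε ε≤1 z+2ε≤n+1 (V-inj (x + p) (εn<N ε ε≤1) (≤n+1⇒<N (ℕ.m+n≤o⇒m≤o z z+2ε≤n+1))
      (trans meets (cong V (trans (ℕ.+-assoc x (2 * m) q)
          (trans (cong (λ y → x + y) (sym p+z≡2m+q)) (sym (ℕ.+-assoc x p z))))))))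
    where
    εn<N : ∀ ε → ε ≤ 1 → ε * n < N
    εn<N zero       _ = ℕ.<-trans (0<step half) n<N
    εn<N (suc zero) _ = subst (_< N) (sym (ℕ.+-identityʳ n)) n<N
    εn<N (suc (suc _)) (s≤s ())
    z+2ε≤n+1 : z + 2 * ε ≤ n + 1
    z+2ε≤n+1 = linear (q + 2 * (2 * m)) (2 * p)
        (ℕ.+-mono-≤ short (ℕ.+-mono-≤ (ℕ.≤-trans length (ℕ.*-monoʳ-≤ 2 l≤m))
        (ℕ.≤-reflexive p+z≡2m+q)))
      (((∀ m p q e z → 2 * (2 * m) + (p + q + 2 * e + (p + z)) ≡
          z + 2 * e + 2 * p + (q + 2 * (2 * m))) ∋ solve-∀) m p q ε z)
      (((∀ m q n → n + 1 + (2 * m + (2 * m + q)) ≡ n + 1 + (q + 2 * (2 * m))) ∋ solve-∀) m q n)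
    conclude : ∀ ε → ε ≤ 1 → z + 2 * ε ≤ n + 1 → ε * n ≡ z → ⊥
    conclude zero       _ _ refl = absurd q (ℕ.<-≤-trans p<2l (ℕ.*-monoʳ-≤ 2 l≤m))
        (cong suc (trans (sym (ℕ.+-identityʳ p)) p+z≡2m+q))
    conclude (suc zero) _ le refl = absurd 0 le
        (((∀ n → 1 * n + 2 * 1 ≡ suc (n + 1 + 0)) ∋ solve-∀) n)
    conclude (suc (suc _)) (s≤s ())

  geodesic : ∀ {m l x} → 2 * (2 * m) ≤ n + 1 → Walk H₅ l (V x) (V (x + 2 * m)) → m ≤ l
  geodesic {m} {l} {x} short w with ℕ.≤-total m l
  ... | inj₁ m≤l = m≤l
  ... | inj₂ l≤m = ℕ.≤-reflexive (sym (proj₁ (shape-rigid {m = m} short l≤m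
    (walk-shape {H₅} {a = x} {x + 2 * m} (λ e → e) w refl refl))))

  module Deletion {t} (step : Step t) (ρ : ℕ) where

    H : Graph (2 * n)
    H = delete H₅ (V ρ) (V (ρ + t))

    -- To run over the link from its far end, a step d needs t + d to be a full turn. As no step
    -- exceeds n, both must be diameters, so the second condition concerns diameters only.
    keep : ∀ {d a} → Step d → (d ≡ t → V a ≢ V ρ) → (d ≡ n → t ≡ n → V a ≢ V (ρ + t)) →
           Adj H (V a) (V (a + d))
    keep {d} {a} s d≡t⇒ d≡n⇒ = step-link a s , λ
      { (inj₁ (a≡ρ , eq)) → d≡t⇒
          (V-inj ρ (step<N s) (step<N step) (trans (sym (V-+ {a} {ρ} d a≡ρ)) eq)) a≡ρ
      ; (inj₂ (a≡ρ+t , eq)) → opposite a≡ρ+t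
          (trans (cong V (sym (ℕ.+-assoc ρ t d))) (trans (sym (V-+ {a} {ρ + t} d a≡ρ+t)) eq)) }
      where
      opposite : V a ≡ V (ρ + t) → V (ρ + (t + d)) ≡ V ρ → ⊥
      opposite a≡ρ+t eq with d ℕ.≟ n | t ℕ.≟ n
      ... | yes p | yes q = d≡n⇒ p q a≡ρ+t
      ... | no d≢n | _ = V-≢ ρ (ℕ.<-≤-trans (0<step step) (ℕ.m≤m+n t d))
        (ℕ.<-≤-trans (ℕ.+-mono-≤-< (step≤n step) (<half s d≢n)) (ℕ.≤-reflexive n+n≡N)) (sym eq)
      ... | _ | no t≢n = V-≢ ρ (ℕ.<-≤-trans (0<step step) (ℕ.m≤m+n t d))
        (ℕ.<-≤-trans (ℕ.+-mono-<-≤ (<half step t≢n) (step≤n s)) (ℕ.≤-reflexive n+n≡N)) (sym eq)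

  -- Deleting a step 1

  module OneLink (ρ : ℕ) where

    open Deletion one ρ public

    one-ok : ∀ {a} → V a ≢ V ρ → Adj H (V a) (V (a + 1))
    one-ok {a} a≢ρ = keep {a = a} one (λ _ → a≢ρ) (λ p _ → contradiction (sym p) n≢1)

    two-ok : ∀ a → Adj H (V a) (V (a + 2))
    two-ok a = keep {a = a} two (λ ()) (λ p _ → contradiction (sym p) n≢2)

    half-ok : ∀ a → Adj H (V a) (V (a + n))
    half-ok a = keep {a = a} half (λ p → contradiction p n≢1) (λ _ p → contradiction (sym p) n≢1)

    evens : ∀ m a → Walk H m (V a) (V (a + 2 * m))
    evens m a = twos {H} m a λ c _ → two-ok (a + 2 * c)

    -- Double steps and diameters all survive. The unit step of an odd arc comes first unless it
    -- would depart from ρ. Then a diameter or a double step goes before it, and without either the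
    -- pair is the link itself.
    reroute : ∀ {l i j} → Normal l i j → SameLink (V ρ) (V (ρ + 1)) i j ⊎ Reroute H l i j
    reroute {l} (normal a y ε ε≤1 refl refl length _) with even-or-odd y
    ... | m , inj₁ refl = inj₂
        (ε + m , ℕ.*-cancelˡ-≤ 2 (ℕ.≤-trans
        (ℕ.≤-reflexive (((∀ m e → 2 * (e + m) ≡ 2 * m + 2 * e) ∋ solve-∀) m ε)) length) ,
      _++_ H (hop {H} half-ok ε a ε≤1)
          (to {H} (((∀ a e m → a + e + 2 * m ≡ a + 2 * m + e) ∋ solve-∀) a (ε * n) m)
          (evens m (a + ε * n))))
    ... | m , inj₂ refl = odd ε m ε≤1
        (ℕ.*-cancelˡ-< 2 _ _ (ℕ.≤-trans
        (ℕ.≤-reflexive (cong suc (((∀ m e → 2 * (e + m) ≡ 2 * m + 2 * e) ∋ solve-∀) m ε)))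
        length))
      where
      odd : ∀ ε m → ε ≤ 1 → suc (ε + m) ≤ l →
            SameLink (V ρ) (V (ρ + 1)) (V a) (V (a + suc (2 * m) + ε * n)) ⊎
            Reroute H l (V a) (V (a + suc (2 * m) + ε * n))
      odd ε m ε≤1 le with V a Fin.≟ V ρ
      ... | no a≢ρ = inj₂ (_ , le , one-ok {a} a≢ρ ∷ _++_ H (hop {H} half-ok ε (a + 1) ε≤1)
        (to {H} (((∀ a e m → a + 1 + e + 2 * m ≡ a + suc (2 * m) + e) ∋ solve-∀) a (ε * n) m)
            (evens m (a + 1 + ε * n))))
      odd (suc zero) m ε≤1 le | yes a≡ρ = inj₂ (_ , le , half-ok a ∷ one-ok {a + n}
        (λ a+n≡ρ → V-≢ a (0<step half) n<N (trans a≡ρ (sym a+n≡ρ))) ∷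
        to {H} (((∀ a n m → a + n + 1 + 2 * m ≡ a + suc (2 * m) + 1 * n) ∋ solve-∀) a n m)
            (evens m (a + n + 1)))
      odd (suc (suc _)) m (s≤s ()) le | yes a≡ρ
      odd zero (suc m) ε≤1 le | yes a≡ρ = inj₂ (_ , le , two-ok a ∷ one-ok {a + 2}
        (λ a+2≡ρ → V-≢ a (0<step two) (step<N two) (trans a≡ρ (sym a+2≡ρ))) ∷
        to {H} (((∀ a m → a + 2 + 1 + 2 * m ≡ a + suc (2 * suc m) + 0) ∋ solve-∀) a m)
            (evens m (a + 2 + 1)))
      odd zero zero ε≤1 le | yes a≡ρ = inj₁ (inj₁ (a≡ρ ,
        trans (cong V (ℕ.+-identityʳ (a + 1))) (V-+ {a} {ρ} 1 a≡ρ)))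

    detour : Walk H 2 (V ρ) (V (ρ + 1))
    detour = two-ok ρ ∷ symm H (subst (λ x → Adj H (V (ρ + 1)) (V x)) (ℕ.+-assoc ρ 1 1)
      (one-ok {ρ + 1} (V-≢ ρ (0<step one) (step<N one) ∘ sym))) ∷ []

  -- Deleting a diameter

  module HalfLink (ρ : ℕ) where

    open Deletion half ρ public

    one-ok : ∀ a → Adj H (V a) (V (a + 1))
    one-ok a = keep {a = a} one (λ p → contradiction (sym p) n≢1)
        (λ p _ → contradiction (sym p) n≢1)

    two-ok : ∀ a → Adj H (V a) (V (a + 2))
    two-ok a = keep {a = a} two (λ p → contradiction (sym p) n≢2)
        (λ p _ → contradiction (sym p) n≢2)

    half-ok : ∀ {a} → V a ≢ V ρ → V a ≢ V (ρ + n) → Adj H (V a) (V (a + n))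
    half-ok {a} a≢ρ a≢ρ+n = keep {a = a} half (λ _ → a≢ρ) (λ _ _ → a≢ρ+n)

    run : ∀ y a → Walk H ⌈ y /2⌉ (V a) (V (a + y))
    run zero          a = to {H} (sym (ℕ.+-identityʳ a)) []
    run (suc zero)    a = one-ok a ∷ []
    run (suc (suc y)) a = two-ok a ∷ to {H} (ℕ.+-assoc a 2 y) (run y (a + 2))

    -- A step with 0 < d < n from one end of the deleted diameter reaches neither of its ends.
    half-moved : ∀ {a d} → Step d → d ≢ n → V a ≡ V ρ ⊎ V a ≡ V (ρ + n) →
                 Adj H (V (a + d)) (V (a + d + n))
    half-moved {a} {d} s d≢n (inj₁ a≡ρ) = half-ok {a + d}
      (λ eq → V-≢ ρ (0<step s) (step<N s) (trans (sym eq) (V-+ {a} {ρ} d a≡ρ)))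
      (λ eq → d≢n (V-inj ρ (step<N s) n<N (trans (sym (V-+ {a} {ρ} d a≡ρ)) eq)))
    half-moved {a} {d} s d≢n (inj₂ a≡ρ+n) = half-ok {a + d}
      (λ eq → V-≢ ρ (ℕ.<-≤-trans (0<step half) (ℕ.m≤m+n n d))
          (ℕ.<-≤-trans (ℕ.+-monoʳ-< n (<half s d≢n)) (ℕ.≤-reflexive n+n≡N))
        (trans (sym eq) (trans (V-+ {a} {ρ + n} d a≡ρ+n) (cong V (ℕ.+-assoc ρ n d)))))
      (λ eq → V-≢ (ρ + n) (0<step s) (step<N s) (trans (sym eq) (V-+ {a} {ρ + n} d a≡ρ+n)))

    -- The diameter is postponed until after the first step of the arc, which moves it off the link.
    -- Only y = 0 offers no such step, and then the pair is the link.
    reroute-blocked : ∀ {l a} y → V a ≡ V ρ ⊎ V a ≡ V (ρ + n) → suc ⌈ y /2⌉ ≤ l →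
      SameLink (V ρ) (V (ρ + n)) (V a) (V (a + y + 1 * n)) ⊎ Reroute H l (V a) (V (a + y + 1 * n))
    reroute-blocked {a = a} zero (inj₁ a≡ρ) _ = inj₁ (inj₁ (a≡ρ ,
      trans (cong V (((∀ a n → a + 0 + 1 * n ≡ a + n) ∋ solve-∀) a n)) (V-+ {a} {ρ} n a≡ρ)))
    reroute-blocked {a = a} zero (inj₂ a≡ρ+n) _ = inj₁ (inj₂ (a≡ρ+n ,
      trans (cong V (((∀ a n → a + 0 + 1 * n ≡ a + n) ∋ solve-∀) a n))
          (trans (V-+ {a} {ρ + n} n a≡ρ+n) (V-turn ρ))))
    reroute-blocked {a = a} (suc zero) p le = inj₂
        (_ , le , one-ok a ∷ half-moved {a} one (n≢1 ∘ sym) p ∷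
      to {H} (cong (λ x → a + 1 + x) (sym (ℕ.+-identityʳ n))) [])
    reroute-blocked {a = a} (suc (suc y)) p le = inj₂
        (_ , le , two-ok a ∷ half-moved {a} two (n≢2 ∘ sym) p ∷
      to {H} (((∀ a n y → a + 2 + n + y ≡ a + (2 + y) + 1 * n) ∋ solve-∀) a n y)
          (run y (a + 2 + n)))

    reroute : ∀ {l i j} → Normal l i j → SameLink (V ρ) (V (ρ + n)) i j ⊎ Reroute H l i j
    reroute {l} (normal a y zero _ refl refl length _) = inj₂
        (_ , ⌈/2⌉≤ {y} {l} (subst (_≤ 2 * l) (ℕ.+-identityʳ y) length) ,
      to {H} (sym (ℕ.+-identityʳ (a + y))) (run y a))
    reroute {l} (normal a y (suc zero) _ refl refl length _) 
      with V a Fin.≟ V ρ | V a Fin.≟ V (ρ + n)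
    ... | no a≢ρ | no a≢ρ+n = inj₂ (_ , ⌈/2⌉≤ {2 + y} {l} (subst (_≤ 2 * l) (ℕ.+-comm y 2) length) ,
      half-ok {a} a≢ρ a≢ρ+n ∷ to {H} (((∀ a n y → a + n + y ≡ a + y + 1 * n) ∋ solve-∀) a n y)
          (run y (a + n)))
    ... | yes p | _ = reroute-blocked {l} {a} y (inj₁ p)
        (⌈/2⌉≤ {2 + y} {l} (subst (_≤ 2 * l) (ℕ.+-comm y 2) length))
    ... | no _ | yes p = reroute-blocked {l} {a} y (inj₂ p)
        (⌈/2⌉≤ {2 + y} {l} (subst (_≤ 2 * l) (ℕ.+-comm y 2) length))
    reroute {l} (normal a y (suc (suc _)) (s≤s ()) refl refl length _)

    detour : Walk H 3 (V ρ) (V (ρ + n))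
    detour = one-ok ρ ∷ half-moved {ρ} one (n≢1 ∘ sym) (inj₁ refl) ∷
      symm H (subst (λ x → Adj H (V (ρ + n)) (V x))
          (((∀ r n → r + n + 1 ≡ r + 1 + n) ∋ solve-∀) ρ n) (one-ok (ρ + n))) ∷ []

  -- Deleting a step 2

  module TwoLink (ρ : ℕ) where

    open Deletion two ρ public

    one-ok : ∀ a → Adj H (V a) (V (a + 1))
    one-ok a = keep {a = a} one (λ ()) (λ p _ → contradiction (sym p) n≢1)

    two-ok : ∀ {a} → V a ≢ V ρ → Adj H (V a) (V (a + 2))
    two-ok {a} a≢ρ = keep {a = a} two (λ _ → a≢ρ) (λ p _ → contradiction (sym p) n≢2)

    half-ok : ∀ a → Adj H (V a) (V (a + n))
    half-ok a = keep {a = a} half (λ p → contradiction p n≢2) (λ _ p → contradiction (sym p) n≢2)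

    -- The run goes forward, so it uses the link exactly when one of its double steps departs from
    -- ρ.
    Hits : ℕ → ℕ → Set
    Hits a m = ∃[ c ] c < m × V (a + 2 * c) ≡ V ρ

    evens : ∀ m a → Hits a m ⊎ Walk H m (V a) (V (a + 2 * m))
    evens zero    a = inj₂ (to {H} (sym (ℕ.+-identityʳ a)) [])
    evens (suc m) a with V a Fin.≟ V ρ
    ... | yes a≡ρ = inj₁ (0 , s≤s z≤n , trans (cong V (ℕ.+-identityʳ a)) a≡ρ)
    ... | no  a≢ρ with evens m (a + 2)
    ...   | inj₁ (c , c<m , eq) = inj₁
        (suc c , s≤s c<m , trans (cong V (((∀ a c → a + 2 * suc c ≡ a + 2 + 2 * c) ∋ solve-∀) a c))
        eq)
    ...   | inj₂ w = inj₂ (two-ok {a} a≢ρ ∷ to {H}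
        (((∀ a c → a + 2 + 2 * c ≡ a + 2 * suc c) ∋ solve-∀) a m) w)

    -- The arcs that rearrangement cannot repair: double steps only, one of them being the link.
    record Crossing (i j : Fin (2 * n)) : Set where
      constructor crossing
      field
        x m   : ℕ
        short : 2 * (2 * m) ≤ n + 1
        hits  : Hits x m
        start : i ≡ V x
        end   : j ≡ V (x + 2 * m)

    reroute : ∀ {l i j} → Normal l i j → Crossing i j ⊎ Reroute H l i j
    reroute {l} (normal a y ε ε≤1 refl refl length short) with even-or-odd y
    ... | m , inj₁ refl = even ε ε≤1 length short
      where
      cost : ∀ ε → 2 * m + 2 * ε ≤ 2 * l → m + ε ≤ l
      cost ε length = ℕ.*-cancelˡ-≤ 2 (ℕ.≤-trans (ℕ.≤-reflexive (ℕ.*-distribˡ-+ 2 m ε)) length)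
      even : ∀ ε → ε ≤ 1 → 2 * m + 2 * ε ≤ 2 * l → 2 * (2 * m + ε) ≤ n + 1 →
             Crossing (V a) (V (a + 2 * m + ε * n)) ⊎ Reroute H l (V a) (V (a + 2 * m + ε * n))
      even zero _ length short with evens m a
      ... | inj₁ hits = inj₁ (crossing a m
          (subst (λ x → 2 * x ≤ n + 1) (ℕ.+-identityʳ (2 * m)) short) hits refl
          (cong V (ℕ.+-identityʳ _)))
      ... | inj₂ w = inj₂ (m , subst (_≤ l) (ℕ.+-identityʳ m) (cost 0 length) , to {H}
          (sym (ℕ.+-identityʳ _)) w)
      even (suc (suc _)) (s≤s ())
      -- The diameter goes first or last. If both runs met the link, then a + n + 2c and a + 2c′
      -- would be the same vertex, although 2c′ < n ≤ n + 2c < 2n.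
      even (suc zero) _ length short with evens m (a + n) | evens m a
      ... | inj₂ w | _ = inj₂ (suc m , subst (_≤ l) (ℕ.+-comm m 1) (cost 1 length) , half-ok a ∷
        to {H} (((∀ a n m → a + n + 2 * m ≡ a + 2 * m + 1 * n) ∋ solve-∀) a n m) w)
      ... | _ | inj₂ w = inj₂ (m + 1 , cost 1 length , _++_ H w
          (hop {H} half-ok 1 (a + 2 * m) ℕ.≤-refl))
      ... | inj₁ (c , c<m , eq) | inj₁ (c′ , c′<m , eq′) = ⊥-elim
          (ℕ.<⇒≢ (ℕ.<-≤-trans (below c′<m) (ℕ.m≤m+n n (2 * c)))
        (sym (V-inj a (ℕ.<-≤-trans (ℕ.+-monoʳ-< n (below c<m)) (ℕ.≤-reflexive n+n≡N))
            (ℕ.<-trans (below c′<m) n<N)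
          (trans (cong V (sym (ℕ.+-assoc a n (2 * c)))) (trans eq (sym eq′))))))
        where
        below : ∀ {c} → c < m → 2 * c < n
        below {c} c<m = linear (4 * m + 1) (2 * c + 4) (ℕ.+-mono-≤ (ℕ.*-monoʳ-≤ 4 c<m) short)
          (((∀ c m → 4 * suc c + 2 * (2 * m + 1) ≡ suc (2 * c) + (2 * c + 4) + (4 * m + 1))
              ∋ solve-∀) c m)
          (((∀ n m → 4 * m + (n + 1) ≡ n + (4 * m + 1)) ∋ solve-∀) n m)
    ... | m , inj₂ refl = odd (evens m (a + 1 + ε * n)) (evens m (a + ε * n))
      where
      cost : suc (ε + m) ≤ l
      cost = ℕ.*-cancelˡ-< 2 _ _
          (ℕ.≤-trans (ℕ.≤-reflexive (cong suc
          (((∀ m e → 2 * (e + m) ≡ 2 * m + 2 * e) ∋ solve-∀) m ε))) length)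
      -- The unit step goes first or else last; the two runs start at positions of different parity.
      odd : Hits (a + 1 + ε * n) m ⊎ Walk H m (V (a + 1 + ε * n)) (V (a + 1 + ε * n + 2 * m)) →
            Hits (a + ε * n) m ⊎ Walk H m (V (a + ε * n)) (V (a + ε * n + 2 * m)) →
            Crossing (V a) (V (a + suc (2 * m) + ε * n)) ⊎
            Reroute H l (V a) (V (a + suc (2 * m) + ε * n))
      odd (inj₂ w) _ = inj₂ (_ , cost , one-ok a ∷ _++_ H (hop {H} half-ok ε (a + 1) ε≤1)
        (to {H} (((∀ a e m → a + 1 + e + 2 * m ≡ a + suc (2 * m) + e) ∋ solve-∀) a (ε * n) m) w))
      odd (inj₁ _) (inj₂ w) = inj₂ (ε + m + 1 , subst (_≤ l) (sym (ℕ.+-comm (ε + m) 1)) cost ,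
        _++_ H (_++_ H (hop {H} half-ok ε a ε≤1) w)
            (to {H} (((∀ a e m → a + e + 2 * m + 1 ≡ a + suc (2 * m) + e) ∋ solve-∀) a (ε * n) m)
          (one-ok (a + ε * n + 2 * m) ∷ [])))
      odd (inj₁ (c , _ , eq)) (inj₁ (c′ , _ , eq′)) = ⊥-elim (suc-parity (a + ε * n) (trans
        (sym (residue (suc (a + ε * n)) c))
            (trans (cong (_% 2) (((∀ a e c → suc (a + e) + 2 * c ≡ a + 1 + e + 2 * c) ∋ solve-∀) a
            (ε * n) c))
        (trans (V-parity (trans eq (sym eq′))) (residue (a + ε * n) c′)))))

    -- A walk of length at most m would have to consist of the m double steps, and c names the one
    -- that was deleted.
    crossing-blocked : ∀ {x m l} → 2 * (2 * m) ≤ n + 1 → Hits x m →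
                       Walk H l (V x) (V (x + 2 * m)) → m < l
    crossing-blocked {x} {m} {l} short (c , c<m , eq) w with m ℕ.<? l
    ... | yes m<l = m<l
    ... | no  m≮l with shape-rigid {H} {l} {m} short (ℕ.≮⇒≥ m≮l)
        (walk-shape {H} {a = x} {x + 2 * m} proj₁ w refl refl)
    ...   | refl , es = ⊥-elim (proj₂ (es c c<m) (inj₁ (eq , V-+ {x + 2 * c} {ρ} 2 eq)))

    -- Splitting one double step into a unit step at either end moves all the others to vertices of
    -- the other parity, away from ρ, for one extra step.
    crossing-detour : ∀ {x m} → 2 * (2 * m) ≤ n + 1 → Hits x m →
                      Walk H (suc m) (V x) (V (x + 2 * m))
    crossing-detour {x} {suc m} short (c , _ , eq) with evens m (x + 1)
    ... | inj₁ (c′ , _ , eq′) = ⊥-elim (suc-parity x (trans (sym (residue (suc x) c′))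
      (trans (cong (_% 2) (((∀ x c → suc x + 2 * c ≡ x + 1 + 2 * c) ∋ solve-∀) x c′))
        (trans (V-parity (trans eq′ (sym eq))) (residue x c)))))
    ... | inj₂ w = subst (λ l → Walk H (suc l) (V x) (V (x + 2 * suc m))) (ℕ.+-comm m 1)
      (one-ok x ∷ _++_ H w (to {H} (((∀ x m → x + 1 + 2 * m + 1 ≡ x + 2 * suc m) ∋ solve-∀) x m)
          (one-ok (x + 1 + 2 * m) ∷ [])))

-- Closeness as a sum of rationals

open import Data.Rational.Base as ℚ using (ℚ; 0ℚ; 1ℚ; ½; _+_; _-_; _*_; _/_)
import Data.Rational.Properties as ℚ
open import Data.Rational.Solver using (module +-*-Solver)
import Data.Rational.Unnormalised.Base as ℚᵘ
import Data.Rational.Unnormalised.Properties as ℚᵘ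

open CMSum ℚ.+-0-commutativeMonoid
  using (sum-remove; ∑-distrib-+; ∑-comm; sum-cong-≗; sum-replicate-zero; sum-init-last)
open +-*-Solver using (solve; _:=_; _:+_; _:*_; :-_; con)

∑-mono : ∀ {n} {f g : Fin n → ℚ} → (∀ i → f i ℚ.≤ g i) → ∑ f ℚ.≤ ∑ g
∑-mono {zero}  f≤g = ℚ.≤-refl
∑-mono {suc n} f≤g = ℚ.+-mono-≤ (f≤g zero) (∑-mono (λ i → f≤g (suc i)))

∑-zero : ∀ {n} {f : Fin n → ℚ} → (∀ i → f i ≡ 0ℚ) → ∑ f ≡ 0ℚ
∑-zero {n} f≡0 = trans (sum-cong-≗ f≡0) (sum-replicate-zero n)

∑-single : ∀ {n} (a : Fin n) {f : Fin n → ℚ} → (∀ i → i ≢ a → f i ≡ 0ℚ) → ∑ f ≡ f a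
∑-single {suc n} a {f} off = trans (sum-remove {i = a} f)
  (trans (cong (λ x → f a + x) (∑-zero λ i → off (Fin.punchIn a i) (Fin.punchInᵢ≢i a i)))
      (ℚ.+-identityʳ _))

∑∑-distrib-+ : ∀ {m n} (f g : Fin m → Fin n → ℚ) →
               ∑ (λ i → ∑ λ j → f i j + g i j) ≡ ∑ (λ i → ∑ (f i)) + ∑ (λ i → ∑ (g i))
∑∑-distrib-+ f g = trans (sum-cong-≗ λ i → ∑-distrib-+ (f i) (g i))
    (∑-distrib-+ (λ i → ∑ (f i)) (λ i → ∑ (g i)))

-- For a variable `n` the gcd in `+ n / 1` is stuck, so the equation is checked on unnormalised
-- fractions.
/1-suc : ∀ n → + suc n / 1 ≡ 1ℚ + + n / 1
/1-suc n = ℚ.toℚᵘ-injective (ℚᵘ.≃-trans (ℚ.toℚᵘ-fromℚᵘ (ℚᵘ.mkℚᵘ (+ suc n) 0))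
  (ℚᵘ.≃-trans (ℚᵘ.*≡* (cong (λ x → (+ 1 ℤ.+ x) ℤ.* + 1) (sym (ℤ.*-identityʳ (+ n)))))
  (ℚᵘ.≃-sym (ℚᵘ.≃-trans (ℚ.toℚᵘ-homo-+ 1ℚ (+ n / 1))
    (ℚᵘ.+-congʳ ℚᵘ.1ℚᵘ (ℚ.toℚᵘ-fromℚᵘ (ℚᵘ.mkℚᵘ (+ n) 0)))))))

∑-const : ∀ n q → ∑ {n} (λ _ → q) ≡ (+ n / 1) * q
∑-const zero    q = sym (ℚ.*-zeroˡ q)
∑-const (suc n) q = trans (cong₂ _+_ (sym (ℚ.*-identityˡ q)) (∑-const n q))
  (trans (sym (ℚ.*-distribʳ-+ q 1ℚ (+ n / 1))) (cong (_* q) (sym (/1-suc n))))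

∑-last : ∀ n (f : ℕ → ℚ) → ∑ {suc n} (λ i → f (toℕ i)) ≡ ∑ {n} (λ i → f (toℕ i)) + f n
∑-last n f = trans (sum-init-last {n} (λ i → f (toℕ i)))
  (cong₂ _+_ (sum-cong-≗ {n} λ i → cong f (Fin.toℕ-inject₁ i)) (cong f (Fin.toℕ-fromℕ n)))

-- The matrix unit at (a, b), scaled by q.
spike : ∀ {n} → Fin n → Fin n → ℚ → Fin n → Fin n → ℚ
spike a b q i j = if does (i Fin.≟ a ×-dec j Fin.≟ b) then q else 0ℚ

spike-on : ∀ {n} {a b i j : Fin n} {q} → i ≡ a → j ≡ b → spike a b q i j ≡ q
spike-on {a = a} {b} {i} {j} {q} p r =
  cong (if_then q else 0ℚ) (dec-true (i Fin.≟ a ×-dec j Fin.≟ b) (p , r))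

spike-off : ∀ {n} {a b i j : Fin n} {q} → ¬ (i ≡ a × j ≡ b) → spike a b q i j ≡ 0ℚ
spike-off {a = a} {b} {i} {j} {q} ¬p =
  cong (if_then q else 0ℚ) (dec-false (i Fin.≟ a ×-dec j Fin.≟ b) ¬p)

∑∑-spike : ∀ {n} (a b : Fin n) q → ∑ (λ i → ∑ (spike a b q i)) ≡ q
∑∑-spike a b q =
  trans (∑-single a {λ i → ∑ (spike a b q i)} λ i i≢a →
    ∑-zero {f = spike a b q i} λ j → spike-off {a = a} {b} {i} {j} λ (p , _) → i≢a p)
  (trans (∑-single b {spike a b q a} λ j j≢b → spike-off {a = a} {b} {a} {j} λ (_ , p) → j≢b p)
    (spike-on {a = a} {b} refl refl))

spike-≥0 : ∀ {n} (a b i j : Fin n) {q} → 0ℚ ℚ.≤ q → 0ℚ ℚ.≤ spike a b q i j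
spike-≥0 a b i j 0≤q with does (i Fin.≟ a ×-dec j Fin.≟ b)
... | true  = 0≤q
... | false = ℚ.≤-refl

minimum-≡ : ∀ {q} qs → All (q ℚ.≤_) qs → q ∈ qs → minimum qs ≡ just q
minimum-≡ (x ∷ qs) (q≤x ∷ q≤qs) q∈ = cong just (ℚ.≤-antisym
  (min≤v⁺ x qs (upper q∈)) (v≤min⁺ q≤x q≤qs))
  where
  open Data.List.Extrema (DecTotalOrder.totalOrder ℚ.≤-decTotalOrder) using (min≤v⁺; v≤min⁺)
  -- The head of the list is the default value of `min`, so it bounds the result just as the
  -- elements of the tail do.
  upper : ∀ {q} → q ∈ (x ∷ qs) → x ℚ.≤ q ⊎ Any (ℚ._≤ q) qs
  upper (here refl) = inj₁ ℚ.≤-refl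
  upper (there p)   = inj₂ (Any.map (λ { refl → ℚ.≤-refl }) p)

½^≥0 : ∀ m → 0ℚ ℚ.≤ ½ ^ℚ m
½^≥0 zero    = ℚ.nonNegative⁻¹ 1ℚ
½^≥0 (suc m) = subst (ℚ._≤ ½ ^ℚ suc m) (ℚ.*-zeroʳ ½) (ℚ.*-monoˡ-≤-nonNeg ½ (½^≥0 m))

½*≤ : ∀ q → 0ℚ ℚ.≤ q → ½ * q ℚ.≤ q
½*≤ q 0≤q = subst (½ * q ℚ.≤_) (ℚ.*-identityˡ q)
  (ℚ.*-monoʳ-≤-nonNeg q {{ℚ.nonNegative 0≤q}} {½} {1ℚ} (ℚ.*≤* (ℤ.+≤+ (s≤s z≤n))))

½^-anti : ∀ {m n} → m ≤ n → ½ ^ℚ n ℚ.≤ ½ ^ℚ m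
½^-anti {n = zero}  z≤n = ℚ.≤-refl
½^-anti {n = suc n} z≤n = ℚ.≤-trans (½*≤ _ (½^≥0 n)) (½^-anti {0} {n} z≤n)
½^-anti (s≤s m≤n) = ℚ.*-monoˡ-≤-nonNeg ½ (½^-anti m≤n)

-- Comparing distances and closeness of two graphs

module _ {n} (G : Graph n) {i j : Fin n} where

  walk⇒½^≤2^-dist : ∀ {m} → Walk G m i j → ½ ^ℚ m ℚ.≤ 2^- dist G i j
  walk⇒½^≤2^-dist {m} w with dist G i j | dist-correct G i j
  ... | just d  | _ , least = ½^-anti (least m w)
  ... | nothing | none      = contradiction w (none m)

  2^-dist≤½^ : ∀ {m} → (∀ l → Walk G l i j → m ≤ l) → 2^- dist G i j ℚ.≤ ½ ^ℚ m
  2^-dist≤½^ {m} m≤ with dist G i j | dist-correct G i j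
  ... | just d  | w , _ = ½^-anti (m≤ d w)
  ... | nothing | _     = ½^≥0 m

-- Phrased with walks of any length instead of distances, so that a disconnected pair needs no
-- separate treatment later.
2^-dist-mono : ∀ {n} (G H : Graph n) {i j i′ j′} →
               (∀ l → Walk G l i j → ∃[ m ] m ≤ l × Walk H m i′ j′) →
               2^- dist G i j ℚ.≤ 2^- dist H i′ j′
2^-dist-mono G H {i} {j} {i′} {j′} shorten with dist G i j | dist-correct G i j
... | nothing | _ with dist H i′ j′
...   | just d  = ½^≥0 d
...   | nothing = ℚ.≤-refl
2^-dist-mono G H shorten | just d | w , _ =
  let (m , m≤d , v) = shorten d w in ℚ.≤-trans (½^-anti m≤d) (walk⇒½^≤2^-dist H v)

term : ∀ {n} → Graph n → Fin n → Fin n → ℚ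
term G i j = if does (i Fin.≟ j) then 0ℚ else 2^- dist G i j

term-≢ : ∀ {n} (G : Graph n) {i j} → i ≢ j → term G i j ≡ 2^- dist G i j
term-≢ G {i} {j} i≢j = cong (if_then 0ℚ else 2^- dist G i j) (dec-false (i Fin.≟ j) i≢j)

term-mono : ∀ {n} (G H : Graph n) {i j} →
            (∀ l → Walk G l i j → ∃[ m ] m ≤ l × Walk H m i j) → term G i j ℚ.≤ term H i j
term-mono G H {i} {j} shorten with does (i Fin.≟ j)
... | true  = ℚ.≤-refl
... | false = 2^-dist-mono G H shorten

closeness-mono : ∀ {n} (G H : Graph n) → (∀ {i j} l → Walk G l i j → Walk H l i j) →
                 closeness G ℚ.≤ closeness H
closeness-mono G H f =
  ∑-mono {f = λ i → ∑ (term G i)} λ i → ∑-mono {f = term G i} {term H i} λ j →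
    term-mono G H λ l w → l , ℕ.≤-refl , f l w

module _ {n} (G H : Graph n) (e : Fin n → Fin n → ℚ) where

  private
    E = ∑ (λ i → ∑ (e i))

    expand : ∑ (λ i → ∑ λ j → term H i j + (e i j + e j i)) ≡ closeness H + (E + E)
    expand = trans (∑∑-distrib-+ (term H) _)
      (cong (λ x → closeness H + x)
          (trans (∑∑-distrib-+ e _) (cong (λ x → E + x) (sym (∑-comm e)))))

  -- `e` records each loss in one orientation of the pair only. Its transpose accounts for the other
  -- one and doubles the total.
  closeness-≤ : (∀ i j → term G i j ℚ.≤ term H i j + (e i j + e j i)) →
                closeness G ℚ.≤ closeness H + (E + E)
  closeness-≤ G≤H = ℚ.≤-trans (∑-mono λ i → ∑-mono (G≤H i)) (ℚ.≤-reflexive expand)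

  closeness-≡ : (∀ i j → term G i j ≡ term H i j + (e i j + e j i)) →
                closeness G ≡ closeness H + (E + E)
  closeness-≡ G≡H = trans (sum-cong-≗ λ i → sum-cong-≗ (G≡H i)) expand

-- For each m < k, the deleted link {r , r + 2} lies on m + 1 geodesics of
-- length m + 1, and each of these distances grows by 1.
loss : ℕ → ℚ
loss k = ∑ {k} λ m → ∑ {suc (toℕ m)} λ _ → ½ ^ℚ (2 ℕ.+ toℕ m)

-- The left side does not change with k: the new summand contributes 2 (k + 1) 2^-(k+2) = (k + 1)
-- 2^-(k+1), and (k + 1) + (k + 3) = 2 (k + 2).
loss-closed : ∀ k → (loss k + loss k) + (+ (k ℕ.+ 2) / 1) * ½ ^ℚ k ≡ + 2 / 1
loss-closed zero    = refl
loss-closed (suc k) = trans (cong₂ (λ x y → (x + x) + y * ½ ^ℚ suc k)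
    (trans (∑-last k (λ m → ∑ {suc m} λ _ → ½ ^ℚ (2 ℕ.+ m))) (cong (λ x → loss k + x)
      (trans (∑-const (suc k) _) (cong (_* ½ ^ℚ (2 ℕ.+ k)) (/1-suc k)))))
    (trans (/1-suc (k ℕ.+ 2)) (cong (λ x → 1ℚ + x) k+2)))
  (trans (step (loss k) (+ k / 1) (½ ^ℚ k))
    (trans (cong (λ y → (loss k + loss k) + y * ½ ^ℚ k) (sym k+2)) (loss-closed k)))
  where
  k+2 : + (k ℕ.+ 2) / 1 ≡ 1ℚ + (1ℚ + + k / 1)
  k+2 = trans (cong (λ x → + x / 1) (ℕ.+-comm k 2))
    (trans (/1-suc (suc k)) (cong (λ x → 1ℚ + x) (/1-suc k)))
  step : ∀ a x h → let b = a + (1ℚ + x) * (½ * (½ * h)) in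
         (b + b) + (1ℚ + (1ℚ + (1ℚ + x))) * (½ * h) ≡ (a + a) + (1ℚ + (1ℚ + x)) * h
  step = solve 3 (λ a x h → let b = a :+ (con 1ℚ :+ x) :* (con ½ :* (con ½ :* h)) in
    (b :+ b) :+ (con 1ℚ :+ (con 1ℚ :+ (con 1ℚ :+ x))) :* (con ½ :* h)
      := (a :+ a) :+ (con 1ℚ :+ (con 1ℚ :+ x)) :* h) refl

∑∑-swap : ∀ {k n} (g : Fin k → Fin n → Fin n → ℚ) →
          ∑ (λ i → ∑ λ j → ∑ λ m → g m i j) ≡ ∑ (λ m → ∑ λ i → ∑ (g m i))
∑∑-swap g = trans (sum-cong-≗ λ i → ∑-comm λ j m → g m i j) (∑-comm λ i m → ∑ (g m i))

term-symm : ∀ {n} (G : Graph n) i j → term G i j ≡ term G j i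
term-symm G i j with i Fin.≟ j | j Fin.≟ i
... | yes _ | yes _ = refl
... | yes p | no ¬p = contradiction (sym p) ¬p
... | no ¬p | yes p = contradiction (sym p) ¬p
... | no _  | no _  = ℚ.≤-antisym
  (turned i j) (turned j i)
  where
  turned : ∀ i j → 2^- dist G i j ℚ.≤ 2^- dist G j i
  turned i j = 2^-dist-mono G G {i} {j} {j} {i} λ l w → l , ℕ.≤-refl , reverse G w

closeness-delete-comm : ∀ {n} (G : Graph n) r s →
                        closeness (delete G r s) ≡ closeness (delete G s r)
closeness-delete-comm G r s = ℚ.≤-antisym
  (closeness-mono (delete G r s) (delete G s r) λ _ → turn)
  (closeness-mono (delete G s r) (delete G r s) λ _ → turn)
  where
  turn : ∀ {r s l i j} → Walk (delete G r s) l i j → Walk (delete G s r) l i j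
  turn []              = []
  turn ((a , ¬rs) ∷ w) = (a , ¬rs ∘ swap) ∷ turn w

delete-term-≤ : ∀ {n} (G : Graph n) r s {i j} → term (delete G r s) i j ℚ.≤ term G i j
delete-term-≤ G r s = term-mono (delete G r s) G λ l w → l , ℕ.≤-refl , forget w
  where
  forget : ∀ {l i j} → Walk (delete G r s) l i j → Walk G l i j
  forget []            = []
  forget ((a , _) ∷ w) = a ∷ forget w

0≤/1 : ∀ m → 0ℚ ℚ.≤ + m / 1
0≤/1 m = ℚ.nonNegative⁻¹ (+ m / 1) {{ℚ.normalize-nonNeg m 1}}

-- Equality holds at k = 2, and from there the value falls because k + 3 ≤ 2 (k + 2).
tail-bound : ∀ k → 2 ≤ k → (+ (k ℕ.+ 2) / 1) * ½ ^ℚ k ℚ.≤ 1ℚ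
tail-bound (suc (suc zero))    _ = ℚ.≤-refl
tail-bound (suc zero) (s≤s ())
tail-bound (suc (suc (suc k))) _ = ℚ.≤-trans decreasing (tail-bound (suc (suc k)) (s≤s (s≤s z≤n)))
  where
  x h rest : ℚ
  x = + (suc k ℕ.+ 2) / 1
  h = ½ ^ℚ suc (suc k)
  rest = x * (½ * h)
  0≤rest : 0ℚ ℚ.≤ rest
  0≤rest = ℚ.nonNegative⁻¹ rest
      {{ℚ.nonNeg*nonNeg⇒nonNeg x {{ℚ.nonNegative (0≤/1 (suc k ℕ.+ 2))}} (½ * h)
      {{ℚ.nonNegative (½^≥0 (suc (suc (suc k))))}}}}
  split : ∀ x h → (1ℚ + x) * h ≡ (1ℚ + (1ℚ + x)) * (½ * h) + x * (½ * h)
  split = solve 2 (λ x h → (con 1ℚ :+ x) :* h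
    := (con 1ℚ :+ (con 1ℚ :+ x)) :* (con ½ :* h) :+ x :* (con ½ :* h)) refl
  decreasing : (+ (3 ℕ.+ k ℕ.+ 2) / 1) * (½ * h) ℚ.≤ (+ (2 ℕ.+ k ℕ.+ 2) / 1) * h
  decreasing = subst₂ ℚ._≤_
    (trans (ℚ.+-identityʳ _) (cong (_* (½ * h))
        (sym (trans (/1-suc (2 ℕ.+ k ℕ.+ 2)) (cong (λ y → 1ℚ + y) (/1-suc (suc k ℕ.+ 2)))))))
    (trans (sym (split x h)) (cong (_* h) (sym (/1-suc (suc k ℕ.+ 2)))))
    (ℚ.+-monoʳ-≤ ((1ℚ + (1ℚ + x)) * (½ * h)) 0≤rest)

-- The drop ½ - ⅛ from distance 1 to the detour of length 3 around a diameter. The detour of length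
-- 2 around a step 1 loses less.
⅜ : ℚ
⅜ = + 3 / 8

≤-+nonNeg : ∀ {p q r} → p ℚ.≤ q → 0ℚ ℚ.≤ r → p ℚ.≤ q + r
≤-+nonNeg {p} p≤q 0≤r = subst (ℚ._≤ _) (ℚ.+-identityʳ p) (ℚ.+-mono-≤ p≤q 0≤r)

module _ {n} (G H : Graph n) (r s : Fin n) (r≢s : r ≢ s)
  (detour : Walk H 3 r s ⊎ Walk H 2 r s)
  (reroute : ∀ {l i j} → Walk G l i j → SameLink r s i j ⊎ ∃[ m ] m ≤ l × Walk H m i j) where

  private
    e : Fin n → Fin n → ℚ
    e = spike r s ⅜

    0≤e : ∀ i j → 0ℚ ℚ.≤ e i j
    0≤e i j = spike-≥0 r s i j (ℚ.nonNegative⁻¹ ⅜)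

    at-link : term G r s ℚ.≤ term H r s + (e r s + e s r)
    at-link = ℚ.≤-trans (subst (ℚ._≤ ½) (sym (term-≢ G r≢s)) (2^-dist≤½^ G {r} {s} {1} positive))
      (ℚ.+-mono-≤ {½ ^ℚ 3} (subst (½ ^ℚ 3 ℚ.≤_) (sym (term-≢ H r≢s)) (bound detour))
        (≤-+nonNeg (ℚ.≤-reflexive (sym (spike-on {a = r} {s} refl refl))) (0≤e s r)))
      where
      positive : ∀ l → Walk G l r s → 1 ≤ l
      positive zero    [] = contradiction refl r≢s
      positive (suc l) _  = s≤s z≤n
      bound : Walk H 3 r s ⊎ Walk H 2 r s → ½ ^ℚ 3 ℚ.≤ 2^- dist H r s
      bound (inj₁ w) = walk⇒½^≤2^-dist H w
      bound (inj₂ w) = ℚ.≤-trans (½^-anti {2} {3} (s≤s (s≤s z≤n))) (walk⇒½^≤2^-dist H w)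

    pointwise : ∀ i j → term G i j ℚ.≤ term H i j + (e i j + e j i)
    pointwise i j with i Fin.≟ r ×-dec j Fin.≟ s | i Fin.≟ s ×-dec j Fin.≟ r
    ... | yes (refl , refl) | _ = at-link
    ... | no _ | yes (refl , refl) = subst₂ ℚ._≤_ (term-symm G r s)
      (cong₂ _+_ (term-symm H r s) (ℚ.+-comm (e r s) (e s r))) at-link
    ... | no ¬p | no ¬q = ≤-+nonNeg (term-mono G H λ l w → kept (reroute w))
      (≤-+nonNeg (0≤e i j) (0≤e j i))
      where
      kept : ∀ {l} → SameLink r s i j ⊎ ∃[ m ] m ≤ l × Walk H m i j → ∃[ m ] m ≤ l × Walk H m i j
      kept (inj₁ (inj₁ p)) = contradiction p ¬p
      kept (inj₁ (inj₂ q)) = contradiction q ¬q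
      kept (inj₂ w)        = w

  lone-loss : closeness G ℚ.≤ closeness H + (⅜ + ⅜)
  lone-loss = subst (λ q → closeness G ℚ.≤ closeness H + (q + q)) (∑∑-spike r s ⅜)
    (closeness-≤ G H e pointwise)

-- The residual closeness

module _ (n : ℕ) (7≤n : 7 ≤ n) where

  open Circulant n 7≤n

  k : ℕ
  k = (n ℕ.+ 1) div 4

  value : ℚ
  value = closeness H₅ - (+ 2 / 1) + (+ (k ℕ.+ 2) / 1) * ½ ^ℚ k

  2≤k : 2 ≤ k
  2≤k = /-monoˡ-≤ 4 (ℕ.+-mono-≤ 7≤n (ℕ.≤-refl {1}))

  -- Bounding the tail by 1 leaves a margin of ¼: q + ¾ - 2 + 1 = q - ¼.
  value-≤ : ∀ {q} → closeness H₅ ℚ.≤ q + (⅜ + ⅜) → value ℚ.≤ q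
  value-≤ {q} le = ℚ.≤-trans (ℚ.+-mono-≤ (ℚ.+-monoˡ-≤ (ℚ.- (+ 2 / 1)) le) (tail-bound k 2≤k))
    (subst (ℚ._≤ q) (sym (regroup q)) (subst (q - + 1 / 4 ℚ.≤_) (ℚ.+-identityʳ q)
      (ℚ.+-monoʳ-≤ q {ℚ.- (+ 1 / 4)} {0ℚ} (ℚ.nonPositive⁻¹ _))))
    where
    regroup : ∀ q → (q + (⅜ + ⅜)) - (+ 2 / 1) + 1ℚ ≡ q - + 1 / 4
    regroup = solve 1 (λ q → (q :+ (con ⅜ :+ con ⅜)) :+ con (ℚ.- (+ 2 / 1)) :+ con 1ℚ
      := q :+ con (ℚ.- (+ 1 / 4))) refl

  -- The exact loss for a deleted step 2

  module _ (ρ : ℕ) where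

    open TwoLink ρ

    -- V (start c) = V (ρ - 2c)
    start : ℕ → ℕ
    start c = ρ ℕ.+ 2 ℕ.* c ℕ.* (N ℕ.∸ 1)

    start-hits : ∀ c → V (start c ℕ.+ 2 ℕ.* c) ≡ V ρ
    start-hits c = trans (cong V (trans (ℕ.+-assoc ρ _ _) (cong (λ x → ρ ℕ.+ x)
      (trans (ℕ.+-comm _ (2 ℕ.* c)) (trans (sym (ℕ.*-suc (2 ℕ.* c) (N ℕ.∸ 1)))
        (cong (λ x → 2 ℕ.* c ℕ.* x) (ℕ.suc-pred N))))))) (V-wrap ρ (2 ℕ.* c))

    source : ℕ → Fin (2 ℕ.* n)
    source c = V (start c)

    target : ℕ → ℕ → Fin (2 ℕ.* n)
    target m c = V (start c ℕ.+ 2 ℕ.* suc m)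

    -- Arc c among those of m + 1 double steps starts 2c units before ρ, so that its double step c
    -- is the link. The weight is the drop from 2^-(m+1) to 2^-(m+2), which is 2^-(m+2) again.
    spikes : (m : Fin k) → Fin (suc (toℕ m)) → Fin (2 ℕ.* n) → Fin (2 ℕ.* n) → ℚ
    spikes m c = spike (source (toℕ c)) (target (toℕ m) (toℕ c)) (½ ^ℚ (2 ℕ.+ toℕ m))

    e : Fin (2 ℕ.* n) → Fin (2 ℕ.* n) → ℚ
    e i j = ∑ λ m → ∑ λ c → spikes m c i j

    ∑∑e : ∑ (λ i → ∑ (e i)) ≡ loss k
    ∑∑e = trans (∑∑-swap λ m i j → ∑ λ c → spikes m c i j) (sum-cong-≗ λ m →
      trans (∑∑-swap (spikes m))
          (sum-cong-≗ {suc (toℕ m)} λ c → ∑∑-spike (source (toℕ c)) (target (toℕ m) (toℕ c))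
          (½ ^ℚ (2 ℕ.+ toℕ m))))

    record Broken (i j : Fin (2 ℕ.* n)) : Set where
      constructor broken
      field
        m : Fin k
        c : Fin (suc (toℕ m))
        at-source : i ≡ source (toℕ c)
        at-target : j ≡ target (toℕ m) (toℕ c)

    broken? : ∀ i j → Dec (Broken i j)
    broken? i j with Fin.any? (λ m → Fin.any? (λ (c : Fin (suc (toℕ m))) →
      i Fin.≟ source (toℕ c) ×-dec j Fin.≟ target (toℕ m) (toℕ c)))
    ... | yes (m , c , p , q) = yes (broken m c p q)
    ... | no ¬p = no λ (broken m c p q) → ¬p (m , c , p , q)

    short : ∀ {m} → m < k → 2 ℕ.* (2 ℕ.* suc m) ≤ n ℕ.+ 1
    short {m} m<k = ℕ.≤-trans (ℕ.≤-reflexive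
        (((∀ m → 2 ℕ.* (2 ℕ.* m) ≡ m ℕ.* 4) ∋ solve-∀) (suc m)))
      (ℕ.≤-trans (ℕ.*-monoˡ-≤ 4 m<k) (m/n*n≤m (n ℕ.+ 1) 4))

    short-< : ∀ {m} → m < k → 2 ℕ.* suc m < N
    short-< {m} m<k = ≤n+1⇒<N (ℕ.≤-trans (ℕ.m≤m+n _ _) (short m<k))

    crossing⇒broken : ∀ {i j} → Crossing i j → Broken i j
    crossing⇒broken (crossing x (suc m) le (c , c<m , hits) refl refl) =
      broken M C (trans x≡ (cong source (sym c≡)))
        (trans (V-+ {x} {start c} (2 ℕ.* suc m) x≡) (cong₂ target (sym m≡) (sym c≡)))
      where
      -- The origin of k: 4 (m + 1) ≤ n + 1 says that m + 1 is at most the integer part of (n + 1) /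
      -- 4.
      m<k : m < k
      m<k = subst (_≤ k) (m*n/n≡m (suc m) 4)
          (/-monoˡ-≤ 4 (subst (_≤ n ℕ.+ 1) (((∀ m → 2 ℕ.* (2 ℕ.* m) ≡ m ℕ.* 4) ∋ solve-∀) (suc m))
          le))
      M = Fin.fromℕ< m<k
      m≡ : toℕ M ≡ m
      m≡ = Fin.toℕ-fromℕ< m<k
      c<M : c < suc (toℕ M)
      c<M = subst (λ m → c < suc m) (sym m≡) c<m
      C = Fin.fromℕ< c<M
      c≡ : toℕ C ≡ c
      c≡ = Fin.toℕ-fromℕ< c<M
      x≡ : V x ≡ V (start c)
      x≡ = V-cancel (2 ℕ.* c) (trans hits (sym (start-hits c)))

    source-inj : ∀ {c c′} → 2 ℕ.* c < N → 2 ℕ.* c′ < N → source c ≡ source c′ → c ≡ c′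
    source-inj {c} {c′} c< c′< eq = ℕ.*-cancelˡ-≡ c c′ 2 (V-inj (start c) c< c′<
      (trans (start-hits c) (trans (sym (start-hits c′))
          (sym (V-+ {start c} {start c′} (2 ℕ.* c′) eq)))))

    index-< : (m : Fin k) (c : Fin (suc (toℕ m))) → 2 ℕ.* toℕ c < N
    index-< m c = ℕ.≤-<-trans (ℕ.*-monoʳ-≤ 2 (ℕ.<⇒≤ (Fin.toℕ<n c))) (short-< (Fin.toℕ<n m))

    -- The source determines c, and then the target determines m, so exactly one spike stands at
    -- this pair.
    broken-on : ∀ {i j} (b : Broken i j) → e i j ≡ ½ ^ℚ (2 ℕ.+ toℕ (Broken.m b))
    broken-on {i} {j} (broken m c refl refl) =
      trans (∑-single m λ m′ m′≢m → ∑-zero λ c′ → spike-off {a = source (toℕ c′)}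
          {target (toℕ m′) (toℕ c′)} {i} {j} {½ ^ℚ (2 ℕ.+ toℕ m′)}
          (λ (p , q) → m′≢m (m-unique m′ c′ p q)))
      (trans (∑-single c λ c′ c′≢c → spike-off {a = source (toℕ c′)} {target (toℕ m) (toℕ c′)} {i}
          {j} (λ (p , q) → c′≢c (Fin.toℕ-injective (sym (c-unique m c′ p)))))
        (spike-on {a = source (toℕ c)} {target (toℕ m) (toℕ c)} refl refl))
      where
      c-unique : ∀ m′ (c′ : Fin (suc (toℕ m′))) → source (toℕ c) ≡ source (toℕ c′) → toℕ c ≡ toℕ c′
      c-unique m′ c′ = source-inj (index-< m c) (index-< m′ c′)
      m-unique : ∀ m′ (c′ : Fin (suc (toℕ m′))) → source (toℕ c) ≡ source (toℕ c′) →
                 target (toℕ m) (toℕ c) ≡ target (toℕ m′) (toℕ c′) → m′ ≡ m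
      m-unique m′ c′ p q = Fin.toℕ-injective (sym (ℕ.suc-injective (ℕ.*-cancelˡ-≡ _ _ 2
        (V-inj (start (toℕ c)) (short-< (Fin.toℕ<n m)) (short-< (Fin.toℕ<n m′))
          (trans q (cong (target (toℕ m′)) (sym (c-unique m′ c′ p))))))))

    broken-off : ∀ {i j} → ¬ Broken i j → e i j ≡ 0ℚ
    broken-off {i} {j} ¬b = ∑-zero λ m → ∑-zero λ c →
      spike-off {a = source (toℕ c)} {target (toℕ m) (toℕ c)} {i} {j} {½ ^ℚ (2 ℕ.+ toℕ m)}
          (λ (p , q) → ¬b (broken m c p q))

    broken-≢ : ∀ {i j} → Broken i j → i ≢ j
    broken-≢ (broken m c refl refl) = V-≢ (start (toℕ c)) (s≤s z≤n) (short-< (Fin.toℕ<n m))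

    -- Two such arcs, there and back, would close a full turn 2n, but each has at most (n + 1) / 2
    -- units. Hence no pair is charged by both `e i j` and `e j i`.
    broken-asym : ∀ {i j} → Broken i j → ¬ Broken j i
    broken-asym (broken m c refl refl) (broken m′ c′ eq eq′) = V-≢ (start (toℕ c)) (s≤s z≤n)
      (≤n+1⇒<N (ℕ.*-cancelˡ-≤ 2 (linear 0 0
          (ℕ.+-mono-≤ (short (Fin.toℕ<n m)) (short (Fin.toℕ<n m′)))
        (((∀ m m′ → 2 ℕ.* (2 ℕ.* suc m) ℕ.+ 2 ℕ.* (2 ℕ.* suc m′) ≡
            2 ℕ.* (2 ℕ.* suc m ℕ.+ 2 ℕ.* suc m′) ℕ.+ 0 ℕ.+ 0) ∋ solve-∀) (toℕ m) (toℕ m′))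
        (((∀ n → n ℕ.+ 1 ℕ.+ (n ℕ.+ 1) ≡ 2 ℕ.* (n ℕ.+ 1) ℕ.+ 0) ∋ solve-∀) n))))
      (trans eq′ (trans (sym (V-+ {start (toℕ c) ℕ.+ 2 ℕ.* suc (toℕ m)} {start (toℕ c′)}
          (2 ℕ.* suc (toℕ m′)) eq))
        (cong V (ℕ.+-assoc (start (toℕ c)) _ _))))

    at-broken : ∀ {i j} → Broken i j → term H₅ i j ≡ term H i j + (e i j + e j i)
    at-broken {i} {j} b@(broken m c refl refl) = trans (trans (term-≢ H₅ (broken-≢ b)) in-G)
      (trans (halves (½ ^ℚ toℕ m)) (sym (cong₂ _+_ (trans (term-≢ H (broken-≢ b)) in-H)
        (cong₂ _+_ (broken-on b) (broken-off (broken-asym b))))))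
      where
      le = short (Fin.toℕ<n m)
      hits : Hits (start (toℕ c)) (suc (toℕ m))
      hits = toℕ c , Fin.toℕ<n c , start-hits (toℕ c)
      two-step : ∀ a → Adj H₅ (V a) (V (a ℕ.+ 2))
      two-step a = step-link a two
      in-G : 2^- dist H₅ i j ≡ ½ ^ℚ suc (toℕ m)
      in-G = ℚ.≤-antisym (2^-dist≤½^ H₅ λ l → geodesic {suc (toℕ m)} {l} {start (toℕ c)} le)
        (walk⇒½^≤2^-dist H₅ (twos {H₅} (suc (toℕ m)) (start (toℕ c)) λ c′ _ → two-step
            (start (toℕ c) ℕ.+ 2 ℕ.* c′)))
      in-H : 2^- dist H i j ≡ ½ ^ℚ (2 ℕ.+ toℕ m)
      in-H = ℚ.≤-antisym (2^-dist≤½^ H λ l → crossing-blocked {start (toℕ c)} {suc (toℕ m)} {l} le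
          hits)
        (walk⇒½^≤2^-dist H (crossing-detour {start (toℕ c)} {suc (toℕ m)} le hits))
      halves : ∀ h → ½ * h ≡ ½ * (½ * h) + (½ * (½ * h) + 0ℚ)
      halves = solve 1 (λ h → con ½ :* h := con ½ :* (con ½ :* h) :+
          (con ½ :* (con ½ :* h) :+ con 0ℚ)) refl

    pointwise : ∀ i j → term H₅ i j ≡ term H i j + (e i j + e j i)
    pointwise i j with broken? i j | broken? j i
    ... | yes b | _     = at-broken b
    ... | no _  | yes b = trans (term-symm H₅ i j) (trans (at-broken b)
      (cong₂ _+_ (term-symm H j i) (ℚ.+-comm (e j i) (e i j))))
    -- Neither orientation is broken: rerouted walks are no longer than before, and a deletion
    -- brings no vertices closer.
    ... | no ¬b | no ¬b′ = trans
        (ℚ.≤-antisym (term-mono H₅ H λ l w → kept (walk-normal w))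
        (delete-term-≤ H₅ (V ρ) (V (ρ ℕ.+ 2))))
      (sym (trans (cong (λ x → term H i j + x) (cong₂ _+_ (broken-off ¬b) (broken-off ¬b′)))
          (ℚ.+-identityʳ _)))
      where
      kept : ∀ {l} → Normal l i j ⊎ Normal l j i → ∃[ m ] m ≤ l × Walk H m i j
      kept (inj₁ p) with reroute p
      ... | inj₁ x = contradiction (crossing⇒broken x) ¬b
      ... | inj₂ w = w
      kept (inj₂ p) with reroute p
      ... | inj₁ x = contradiction (crossing⇒broken x) ¬b′
      ... | inj₂ (m , m≤l , w) = m , m≤l , reverse H w

    two-link : closeness H ≡ value
    two-link = sym (trans (cong (λ x → x - (+ 2 / 1) + tail) (trans (closeness-≡ H₅ H e pointwise)
        (cong (λ x → closeness H + (x + x)) ∑∑e)))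
      (trans (cong (λ x → closeness H + (loss k + loss k) - x + tail) (sym (loss-closed k)))
        (cancel (closeness H) (loss k + loss k) tail)))
      where
      tail = (+ (k ℕ.+ 2) / 1) * ½ ^ℚ k
      cancel : ∀ x y z → x + y - (y + z) + z ≡ x
      cancel = solve 3 (λ x y z → x :+ y :+ (:- (y :+ z)) :+ z := x) refl

  reroute-walk : ∀ {r s l i j} (let K = delete H₅ r s) →
                 (∀ {i j} → Normal l i j → SameLink r s i j ⊎ Reroute K l i j) →
                 Walk H₅ l i j → SameLink r s i j ⊎ Reroute K l i j
  reroute-walk {r} {s} f w with walk-normal w
  ... | inj₁ p = f p
  ... | inj₂ p = Sum.map
    (λ { (inj₁ (p , q)) → inj₂ (q , p) ; (inj₂ (p , q)) → inj₁ (q , p) })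
    (λ (m , m≤l , v) → m , m≤l , reverse (delete H₅ r s) v) (f p)

  value-≤-forward : ∀ {d} → Step d → ∀ ρ → value ℚ.≤ closeness (delete H₅ (V ρ) (V (ρ ℕ.+ d)))
  value-≤-forward one ρ = value-≤
      (lone-loss H₅ H (V ρ) (V (ρ ℕ.+ 1)) (V-≢ ρ (0<step one) (step<N one))
    (inj₂ detour) (reroute-walk reroute))
    where open OneLink ρ
  value-≤-forward two ρ = ℚ.≤-reflexive (sym (two-link ρ))
  value-≤-forward half ρ = value-≤
      (lone-loss H₅ H (V ρ) (V (ρ ℕ.+ n)) (V-≢ ρ (0<step half) (step<N half))
    (inj₁ detour) (reroute-walk reroute))
    where open HalfLink ρ

  value-≤-link : ∀ {r s} → Adj H₅ r s → value ℚ.≤ closeness (delete H₅ r s)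
  value-≤-link {r} {s} a with step-from-link a
  ... | d , st , inj₁ refl = subst (λ r′ → value ℚ.≤ closeness (delete H₅ r′ (V (toℕ r ℕ.+ d))))
      (V-toℕ r)
    (value-≤-forward st (toℕ r))
  ... | d , st , inj₂ refl = subst (value ℚ.≤_) (closeness-delete-comm H₅ s (V (toℕ s ℕ.+ d)))
    (subst (λ s′ → value ℚ.≤ closeness (delete H₅ s′ (V (toℕ s ℕ.+ d)))) (V-toℕ s)
        (value-≤-forward st (toℕ s)))

  harary₅-residual : linkResidualCloseness H₅ ≡ just value
  harary₅-residual = minimum-≡ _
    (All.map⁺ (All.map (λ {x} → value-≤-link)
        (All.all-filter (uncurry (adj? H₅)) (cartesianProduct (allFin _) (allFin _)))))
    -- Every step 2 attains the value; the link from 0 to 2 serves as the witness.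
    (subst (_∈ map residual (links H₅)) (two-link 0)
      (∈-map⁺ residual {V 0 , V 2}
          (∈-filter⁺ (uncurry (adj? H₅)) (∈-cartesianProduct⁺ (∈-allFin (V 0)) (∈-allFin (V 2)))
          (step-link 0 two))))
    where
    residual : Fin (2 ℕ.* n) × Fin (2 ℕ.* n) → ℚ
    residual (r , s) = closeness (delete H₅ r s)

theorem4 : ∀ (n : ℕ) → 7 ≤ n →
    let k = (n ℕ.+ 1) div 4 in
    linkResidualCloseness (harary₅ n)
    ≡ just (closeness (harary₅ n) - (+ 2 / 1) + (+ (k ℕ.+ 2) / 1) * ½ ^ℚ k)
theorem4 = harary₅-residual
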